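{- Let $\varphi(x,y,z)$ be any $\Sigma$-formula of first-order arithmetic that defines the (non-hereditary) Goodstein sequences, in the sense that for all $i,k,n\in\mathbb N$ $$G_n(i)=k\quad\Longleftrightarrow\quad\mathbb N\vDash\varphi(n,i,k).$$ Then $\mathsf{I\Sigma}_1\nvdash\forall x\,\exists y\,\varphi(x,y,0)$. That is, the termination of non-hereditary Goodstein sequences is unprovable in $\mathsf{I\Sigma}_1$.
   Context: Base-$b$ normal form: for $b\ge 2$ and $n>0$, write $n=_{b\text{ - }\mathsf{NF}}b^{e_0}\cdot c_0+\ldots+b^{e_k}\cdot c_k$ if equality holds, $e_0>\ldots>e_k$ and $0<c_i<b$ for all $i\le k$. Each $n>0$ has a unique such form. Goodstein sequence with start value $n\in\mathbb N$: the function $G_n:\mathbb N\to\mathbb N$ with $G_n(0)=n$ and: if $G_n(i)=0$ then $G_n(i+1)=0$; if $0<G_n(i)=_{(i+2)\text{ - }\mathsf{NF}}(i+2)^{e_0}\cdot c_0+\ldots+(i+2)^{e_k}\cdot c_k$, then $G_n(i+1)=(i+3)^{e_0}\cdot c_0+\ldots+(i+3)^{e_k}\cdot c_k-1$ (exponents are not rewritten in normal form). The sequence terminates if $G_n(i)=0$ for some $i$. First-order arithmetic has the signature $0$ (constant), $S$ (unary function), $+,\times$ (binary functions), $=,\le$ (binary relations); $\mathbb N$ also denotes the standard model. Formulas are in negation normal form (negation only in front of atomic formulas; $\varphi\to\psi$ abbreviates $\neg\varphi\lor\psi$, with negation pushed to the atoms by the de Morgan laws). $\Sigma$-formulas: generated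 from literals (atomic formulas and negated atomic formulas) by $\land$, $\lor$, bounded quantifiers $\forall x(x\le t\to\varphi)$ and $\exists x(x\le t\land\varphi)$ with $t$ a term in which $x$ does not occur, and unbounded existential quantifiers $\exists x\,\varphi$. A bounded formula is one generated without unbounded existential quantifiers. A $\Sigma_1$-formula is one of the form $\exists x\,\theta$ with $\theta$ bounded. Robinson arithmetic $\mathsf Q$ consists of the equality axioms and the universal closures of: $Sx=Sy\to x=y$; $x\ne 0\leftrightarrow\exists y\,x=Sy$; $x\le y\leftrightarrow\exists z\,z+x=y$; $x+0=x$; $x+Sy=S(x+y)$; $x\times 0=0$; $x\times Sy=(x\times y)+x$. The theory $\mathsf{I\Sigma}_1$ consists of $\mathsf Q$ together with, for every $\Sigma_1$-formula $\varphi(x)$ (possibly with further free variables as parameters), the universal closure of $\varphi(0)\land\forall x(\varphi(x)\to\varphi(Sx))\to\forall x\,\varphi(x)$. $\mathsf T\vdash\psi$ is provability in classical first-order logic. -}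

module Defs where

open import Data.Fin using (Fin; zero; suc)
open import Data.List using (List; []; _∷_; _++_; map)
open import Data.List.Properties using (map-∘; map-++)
open import Data.List.Relation.Binary.Subset.Propositional using (_⊆_)
open import Data.List.Relation.Unary.All as All using (All; []; _∷_)
import Data.List.Relation.Unary.All.Properties as All
open import Data.List.Relation.Unary.AllPairs as AllPairs using (AllPairs; []; _∷_)
import Data.List.Relation.Unary.AllPairs.Properties as AllPairs
open import Data.Nat
open import Data.Nat.DivMod using (m≡m%n+[m/n]*n; m%n<n; m/n<m)
open import Data.Nat.Induction using (Acc; acc; <-wellFounded)
open import Data.Nat.ListAction using (sum)
open import Data.Nat.ListAction.Properties using (sum-++)
open import Data.Nat.Properties
open import Data.Nat.Tactic.RingSolver using (solve-∀)
open import Data.Product using (∃-syntax; _×_; _,_; proj₁; proj₂)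
open import Data.Sum using (_⊎_)
open import Data.Vec.Functional using (Vector) renaming (_∷_ to _∷ᶠ_)
open import Function using (_∘_)
open import Relation.Binary.PropositionalEquality using (_≡_; refl; sym; trans; cong)
open import Relation.Nullary using (¬_)

-- The list (e₀ , c₀) ∷ … ∷ (eₖ , cₖ) ∷ [] stands for bᵉ⁰·c₀ + … + bᵉᵏ·cₖ,
-- with the base b left open.

Expansion : Set
Expansion = List (ℕ × ℕ)

evalTerm : ℕ → ℕ × ℕ → ℕ
evalTerm b (e , c) = b ^ e * c

eval : ℕ → Expansion → ℕ
eval b = sum ∘ map (evalTerm b)

-- 0 has the empty normal form.

record _=[_]NF_ (n b : ℕ) (p : Expansion) : Set where
  constructor mkNF
  field
    value        : n ≡ eval b p
    decreasing   : AllPairs (λ s t → proj₁ s > proj₁ t) p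
    coefficients : All (λ t → 0 < proj₂ t × proj₂ t < b) p

private
  shift : ℕ × ℕ → ℕ × ℕ
  shift (e , c) = suc e , c

  eval-shift : ∀ b p → eval b (map shift p) ≡ eval b p * b
  eval-shift b []            = refl
  eval-shift b ((e , c) ∷ p) rewrite eval-shift b p = lemma b (b ^ e) c (eval b p)
    where
    lemma : ∀ b q c r → b * q * c + r * b ≡ (q * c + r) * b
    lemma = solve-∀

  eval-snoc : ∀ b p c → eval b (map shift p ++ (0 , c) ∷ []) ≡ c + eval b p * b
  eval-snoc b p c
    rewrite map-++ (evalTerm b) (map shift p) ((0 , c) ∷ [])
          | sum-++ (map (evalTerm b) (map shift p)) (1 * c ∷ [])
          | eval-shift b p
    = lemma (eval b p * b) c
    where
    lemma : ∀ r c → r + (1 * c + 0) ≡ c + r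
    lemma = solve-∀

  normalFormAcc : ∀ b → .{{NonTrivial b}} → ∀ n → Acc _<_ n → ∃[ p ] n =[ b ]NF p
  normalFormAcc b zero    _        = [] , mkNF refl [] []
  normalFormAcc b (suc m) (acc rs) = extend (n % b) (m≡m%n+[m/n]*n n b) (m%n<n n b)
    (normalFormAcc b (n / b) (rs (m/n<m n b (nonTrivial⇒n>1 b))))
    where
    n = suc m

    instance
      b≢0 : NonZero b
      b≢0 = nonTrivial⇒nonZero b

    extend : ∀ {q} r → n ≡ r + q * b → r < b →
             ∃[ p ] q =[ b ]NF p → ∃[ p ] n =[ b ]NF p
    extend zero n≡ _ (p , mkNF v d c) = map shift p , mkNF
      (trans n≡ (trans (cong (_* b) v) (sym (eval-shift b p))))
      (AllPairs.map⁺ (AllPairs.map s<s d))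
      (All.map⁺ c)
    extend r@(suc _) n≡ r<b (p , mkNF v d c) = map shift p ++ (0 , r) ∷ [] , mkNF
      (trans n≡ (trans (cong (λ z → r + z * b) v) (sym (eval-snoc b p r))))
      (AllPairs.++⁺ (AllPairs.map⁺ (AllPairs.map s<s d)) ([] ∷ [])
        (All.map⁺ (All.universal (λ _ → z<s ∷ []) p)))
      (All.++⁺ (All.map⁺ c) ((z<s , r<b) ∷ []))

normalForm : ∀ b → .{{NonTrivial b}} → ∀ n → ∃[ p ] n =[ b ]NF p
normalForm b n = normalFormAcc b n (<-wellFounded n)

goodsteinStep : ℕ → ℕ → ℕ
goodsteinStep i zero      = zero
goodsteinStep i m@(suc _) = eval (3 + i) (proj₁ (normalForm (2 + i) m)) ∸ 1

G : ℕ → ℕ → ℕ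
G n zero    = n
G n (suc i) = goodsteinStep i (G n i)

infixl 7 _⊗_
infixl 6 _⊕_

data Term (n : ℕ) : Set where
  var     : Fin n → Term n
  `0      : Term n
  `S      : Term n → Term n
  _⊕_ _⊗_ : Term n → Term n → Term n

infix 5 _≐_ _≼_

data Atom (n : ℕ) : Set where
  _≐_ _≼_ : Term n → Term n → Atom n

infixr 4 _`∧_
infixr 3 _`∨_

data Formula (n : ℕ) : Set where
  pos neg   : Atom n → Formula n
  _`∧_ _`∨_ : Formula n → Formula n → Formula n
  `∀ `∃     : Formula (suc n) → Formula n

private
  variable
    m n : ℕ

∼_ : Formula n → Formula n
∼ pos a    = neg a
∼ neg a    = pos a
∼ (φ `∧ ψ) = (∼ φ) `∨ (∼ ψ)
∼ (φ `∨ ψ) = (∼ φ) `∧ (∼ ψ)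
∼ `∀ φ     = `∃ (∼ φ)
∼ `∃ φ     = `∀ (∼ φ)

infixr 2 _⇒_
infix  1 _⇔̇_

_⇒_ _⇔̇_ : Formula n → Formula n → Formula n
φ ⇒ ψ = (∼ φ) `∨ ψ
φ ⇔̇ ψ = (φ ⇒ ψ) `∧ (ψ ⇒ φ)

renameTerm : (Fin m → Fin n) → Term m → Term n
renameTerm ρ (var x) = var (ρ x)
renameTerm ρ `0      = `0
renameTerm ρ (`S t)  = `S (renameTerm ρ t)
renameTerm ρ (s ⊕ t) = renameTerm ρ s ⊕ renameTerm ρ t
renameTerm ρ (s ⊗ t) = renameTerm ρ s ⊗ renameTerm ρ t

Subst : ℕ → ℕ → Set
Subst m n = Fin m → Term n

lift : Subst m n → Subst (suc m) (suc n)
lift σ = var zero ∷ᶠ (renameTerm suc ∘ σ)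

substTerm : Subst m n → Term m → Term n
substTerm σ (var x) = σ x
substTerm σ `0      = `0
substTerm σ (`S t)  = `S (substTerm σ t)
substTerm σ (s ⊕ t) = substTerm σ s ⊕ substTerm σ t
substTerm σ (s ⊗ t) = substTerm σ s ⊗ substTerm σ t

substAtom : Subst m n → Atom m → Atom n
substAtom σ (s ≐ t) = substTerm σ s ≐ substTerm σ t
substAtom σ (s ≼ t) = substTerm σ s ≼ substTerm σ t

substFormula : Subst m n → Formula m → Formula n
substFormula σ (pos a)  = pos (substAtom σ a)
substFormula σ (neg a)  = neg (substAtom σ a)
substFormula σ (φ `∧ ψ) = substFormula σ φ `∧ substFormula σ ψ
substFormula σ (φ `∨ ψ) = substFormula σ φ `∨ substFormula σ ψ
substFormula σ (`∀ φ)   = `∀ (substFormula (lift σ) φ)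
substFormula σ (`∃ φ)   = `∃ (substFormula (lift σ) φ)

infixl 8 _⟪_⟫ _[_]

_⟪_⟫ : Formula m → Subst m n → Formula n
φ ⟪ σ ⟫ = substFormula σ φ

_[_] : Formula (suc n) → Term n → Formula n
φ [ t ] = φ ⟪ t ∷ᶠ var ⟫

weaken : Formula n → Formula (suc n)
weaken φ = φ ⟪ var ∘ suc ⟫

Sentence : Set
Sentence = Formula 0

embed : Sentence → Formula n
embed φ = φ ⟪ (λ ()) ⟫

closure : Formula n → Sentence
closure {zero}  φ = φ
closure {suc n} φ = closure (`∀ φ)

pattern x₀ = var zero
pattern x₁ = var (suc zero)
pattern x₂ = var (suc (suc zero))
pattern x₃ = var (suc (suc (suc zero)))

⟦_⟧ : Term n → Vector ℕ n → ℕ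
⟦ var x ⟧ ρ = ρ x
⟦ `0    ⟧ ρ = 0
⟦ `S t  ⟧ ρ = suc (⟦ t ⟧ ρ)
⟦ s ⊕ t ⟧ ρ = ⟦ s ⟧ ρ + ⟦ t ⟧ ρ
⟦ s ⊗ t ⟧ ρ = ⟦ s ⟧ ρ * ⟦ t ⟧ ρ

ℕ⊨ᵃ[_]_ : Vector ℕ n → Atom n → Set
ℕ⊨ᵃ[ ρ ] (s ≐ t) = ⟦ s ⟧ ρ ≡ ⟦ t ⟧ ρ
ℕ⊨ᵃ[ ρ ] (s ≼ t) = ⟦ s ⟧ ρ ≤ ⟦ t ⟧ ρ

ℕ⊨[_]_ : Vector ℕ n → Formula n → Set
ℕ⊨[ ρ ] pos a    = ℕ⊨ᵃ[ ρ ] a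
ℕ⊨[ ρ ] neg a    = ¬ (ℕ⊨ᵃ[ ρ ] a)
ℕ⊨[ ρ ] (φ `∧ ψ) = ℕ⊨[ ρ ] φ × ℕ⊨[ ρ ] ψ
ℕ⊨[ ρ ] (φ `∨ ψ) = ℕ⊨[ ρ ] φ ⊎ ℕ⊨[ ρ ] ψ
ℕ⊨[ ρ ] `∀ φ     = ∀ a → ℕ⊨[ a ∷ᶠ ρ ] φ
ℕ⊨[ ρ ] `∃ φ     = ∃[ a ] ℕ⊨[ a ∷ᶠ ρ ] φ

-- The bound lives in the outer context, so the bound variable does not occur in it.

∀≼ ∃≼ : Term n → Formula (suc n) → Formula n
∀≼ t φ = `∀ (pos (x₀ ≼ renameTerm suc t) ⇒ φ)
∃≼ t φ = `∃ (pos (x₀ ≼ renameTerm suc t) `∧ φ)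

data IsBounded {n : ℕ} : Formula n → Set where
  pos  : ∀ a → IsBounded (pos a)
  neg  : ∀ a → IsBounded (neg a)
  _`∧_ : ∀ {φ ψ} → IsBounded φ → IsBounded ψ → IsBounded (φ `∧ ψ)
  _`∨_ : ∀ {φ ψ} → IsBounded φ → IsBounded ψ → IsBounded (φ `∨ ψ)
  bd∀  : ∀ t {φ} → IsBounded φ → IsBounded (∀≼ t φ)
  bd∃  : ∀ t {φ} → IsBounded φ → IsBounded (∃≼ t φ)

data IsΣ₁ {n : ℕ} : Formula n → Set where
  `∃ : ∀ {θ} → IsBounded θ → IsΣ₁ (`∃ θ)

data IsΣ {n : ℕ} : Formula n → Set where
  pos  : ∀ a → IsΣ (pos a)
  neg  : ∀ a → IsΣ (neg a)
  _`∧_ : ∀ {φ ψ} → IsΣ φ → IsΣ ψ → IsΣ (φ `∧ ψ)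
  _`∨_ : ∀ {φ ψ} → IsΣ φ → IsΣ ψ → IsΣ (φ `∨ ψ)
  bd∀  : ∀ t {φ} → IsΣ φ → IsΣ (∀≼ t φ)
  bd∃  : ∀ t {φ} → IsΣ φ → IsΣ (∃≼ t φ)
  `∃   : ∀ {φ} → IsΣ φ → IsΣ (`∃ φ)

Theory : Set₁
Theory = Sentence → Set

-- A one-sided (Tait) sequent calculus with cut and the axioms of T as initial
-- sequents; a sequent is read as the disjunction of its members.

infix 0 _⊢ˢ_ _⊢_

data _⊢ˢ_ (T : Theory) : {n : ℕ} → List (Formula n) → Set where
  axiom      : ∀ {σ} {Γ : List (Formula n)} → T σ → T ⊢ˢ embed σ ∷ Γ
  identity   : ∀ {a} {Γ : List (Formula n)} → T ⊢ˢ pos a ∷ neg a ∷ Γ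
  structural : ∀ {Γ Δ : List (Formula n)} → Γ ⊆ Δ → T ⊢ˢ Γ → T ⊢ˢ Δ
  ∧-intro    : ∀ {φ ψ} {Γ : List (Formula n)} →
               T ⊢ˢ φ ∷ Γ → T ⊢ˢ ψ ∷ Γ → T ⊢ˢ (φ `∧ ψ) ∷ Γ
  ∨-intro    : ∀ {φ ψ} {Γ : List (Formula n)} →
               T ⊢ˢ φ ∷ ψ ∷ Γ → T ⊢ˢ (φ `∨ ψ) ∷ Γ
  ∀-intro    : ∀ {φ} {Γ : List (Formula n)} →
               T ⊢ˢ φ ∷ map weaken Γ → T ⊢ˢ `∀ φ ∷ Γ
  ∃-intro    : ∀ {φ} {Γ : List (Formula n)} (t : Term n) →
               T ⊢ˢ φ [ t ] ∷ Γ → T ⊢ˢ `∃ φ ∷ Γ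
  cut        : ∀ {φ} {Γ : List (Formula n)} →
               T ⊢ˢ φ ∷ Γ → T ⊢ˢ (∼ φ) ∷ Γ → T ⊢ˢ Γ

_⊢_ : Theory → Sentence → Set
T ⊢ ψ = T ⊢ˢ ψ ∷ []

data Q : Theory where
  ≐-refl  : Q (closure {1} (pos (x₀ ≐ x₀)))
  ≐-sym   : Q (closure {2} (pos (x₀ ≐ x₁) ⇒ pos (x₁ ≐ x₀)))
  ≐-trans : Q (closure {3} (pos (x₀ ≐ x₁) `∧ pos (x₁ ≐ x₂) ⇒ pos (x₀ ≐ x₂)))
  S-cong  : Q (closure {2} (pos (x₀ ≐ x₁) ⇒ pos (`S x₀ ≐ `S x₁)))
  ⊕-cong  : Q (closure {4} (pos (x₀ ≐ x₁) `∧ pos (x₂ ≐ x₃) ⇒ pos (x₀ ⊕ x₂ ≐ x₁ ⊕ x₃)))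
  ⊗-cong  : Q (closure {4} (pos (x₀ ≐ x₁) `∧ pos (x₂ ≐ x₃) ⇒ pos (x₀ ⊗ x₂ ≐ x₁ ⊗ x₃)))
  ≼-cong  : Q (closure {4}
              (pos (x₀ ≐ x₁) `∧ pos (x₂ ≐ x₃) ⇒ pos (x₀ ≼ x₂) ⇒ pos (x₁ ≼ x₃)))

  S-inj   : Q (closure {2} (pos (`S x₀ ≐ `S x₁) ⇒ pos (x₀ ≐ x₁)))
  ≠0-def  : Q (closure {1} (neg (x₀ ≐ `0) ⇔̇ `∃ (pos (x₁ ≐ `S x₀))))
  ≼-def   : Q (closure {2} (pos (x₀ ≼ x₁) ⇔̇ `∃ (pos (x₀ ⊕ x₁ ≐ x₂))))
  ⊕-0     : Q (closure {1} (pos (x₀ ⊕ `0 ≐ x₀)))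
  ⊕-S     : Q (closure {2} (pos (x₀ ⊕ `S x₁ ≐ `S (x₀ ⊕ x₁))))
  ⊗-0     : Q (closure {1} (pos (x₀ ⊗ `0 ≐ `0)))
  ⊗-S     : Q (closure {2} (pos (x₀ ⊗ `S x₁ ≐ (x₀ ⊗ x₁) ⊕ x₀)))

-- The induction variable is x₀; the remaining free variables are parameters.

induction : Formula (suc n) → Formula n
induction φ = φ [ `0 ] `∧ `∀ (φ ⇒ φ ⟪ `S x₀ ∷ᶠ (var ∘ suc) ⟫) ⇒ `∀ φ

data IΣ₁ : Theory where
  robinson : ∀ {σ} → Q σ → IΣ₁ σ
  Σ₁-ind   : {φ : Formula (suc n)} → IsΣ₁ φ → IΣ₁ (closure (induction φ))

{-# OPTIONS --safe #-}
module Submission where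

-- The Goodstein sequence of 2ᵉ⁺¹ is still positive at time F e 0, where the F e form a
-- fast-growing hierarchy that diagonalises over the primitive recursive functions. To see
-- that IΣ₁ does not prove termination, ℕ is replaced by a generic cut closed under all F k,
-- through a forcing interpretation of classical logic whose conditions are families of
-- intervals around the cut. Such cuts satisfy Σ₁-induction, and what is forced of a
-- Σ-formula is true, so a proof of termination would bound F e 0 by F k (2ᵉ⁺¹) for one k.

open import Defs
open import Data.Fin using (Fin; zero; suc; toℕ; fromℕ<)
open import Data.Fin.Properties using (toℕ-fromℕ<)
open import Data.Fin.Subset as Subset using (Subset; ∣_∣)
open import Data.Fin.Subset.Properties using (∣p∣≤n; p⊆q⇒∣p∣≤∣q∣; p⊂q⇒∣p∣<∣q∣)
open import Data.Nat
open import Data.Nat.GeneralisedArithmetic using (fold)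
open import Data.Nat.Properties
open import Data.Nat.Tactic.RingSolver using (solve-∀)
open import Data.Product using (Σ; Σ-syntax; ∃-syntax; _×_; _,_; proj₁; proj₂)
open import Data.Sum using (_⊎_; inj₁; inj₂; [_,_]′)
open import Data.Vec using (tabulate)
open import Data.Vec.Functional using (Vector)
open import Data.Vec.Properties using (lookup∘tabulate; []=⇒lookup; lookup⇒[]=)
open import Function using (_∘_; id; case_of_)
open import Function.Bundles using (_⇔_; Equivalence)
open import Relation.Binary.Definitions using (tri<; tri≈; tri>)
open import Relation.Binary.PropositionalEquality hiding ([_])
open import Relation.Nullary
open import Relation.Nullary.Decidable using (dec-true; decidable-stable; map′; _×-dec_; _⊎-dec_; ¬?)
open import Relation.Unary using (Decidable)

-- No nonstandard model is built. An element of the generic cut is named by a function on the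
-- indices of a world that stays below one `F k` applied to `lo`, and atomic truth is judged index
-- by index. Only the level `k` has to be uniform: a world is proper when no single `k` serves all
-- its indices. For fixed `k` the inequality `hi < F k lo` is decidable at each index, so case
-- distinctions on arithmetic truth are available constructively. The obstacle is induction, because
-- having a witness in the cut is not a decidable property of a number; splitting the intervals
-- replaces it by one that is. The recursion for `F (suc e) i`, with 2 + i iterations from `suc i`,
-- serves both halves. One step after base 2 + i, the summand (3 + i)^(e+1) lowered by 1 still
-- contains 2 + i copies of (3 + i)^e, present at time `suc i`. In the induction proof, an induction
-- bound below z costs 2 + z iterations of `F k`, which is one level more.

module GoodsteinGrowth where

  open import Data.List using (List; []; _∷_; map)
  open import Data.List.Relation.Unary.All as All using (All; []; _∷_)
  import Data.List.Relation.Unary.All.Properties as All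
  open import Data.List.Relation.Unary.AllPairs as AllPairs using (AllPairs; []; _∷_)
  import Data.List.Relation.Unary.AllPairs.Properties as AllPairs

  -- The fast-growing hierarchy

  fold-inflationary : ∀ {f} → (∀ x → x ≤ f x) → ∀ n {x} → x ≤ fold x f n
  fold-inflationary f-infl zero    = ≤-refl
  fold-inflationary f-infl (suc n) = ≤-trans (fold-inflationary f-infl n) (f-infl _)

  fold-mono : ∀ {f g} → (∀ {x y} → x ≤ y → f x ≤ g y) →
              ∀ n {x y} → x ≤ y → fold x f n ≤ fold y g n
  fold-mono f≤g zero    x≤y = x≤y
  fold-mono f≤g (suc n) x≤y = f≤g (fold-mono f≤g n x≤y)

  fold-monoʳ : ∀ {f} → (∀ x → x ≤ f x) → ∀ {m n} → m ≤ n → ∀ {x} → fold x f m ≤ fold x f n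
  fold-monoʳ {f} f-infl m≤n = go (≤⇒≤′ m≤n)
    where
    go : ∀ {m n x} → m ≤′ n → fold x f m ≤ fold x f n
    go (≤′-reflexive refl) = ≤-refl
    go (≤′-step m≤′n)      = ≤-trans (go m≤′n) (f-infl _)

  -- F e i bounds from below the time at which a Goodstein sequence has used up
  -- one summand bᵉ that it contains at time i, when the base b is 2 + i.

  F : ℕ → ℕ → ℕ
  F zero    i = suc i
  F (suc e) i = fold (suc i) (F e) (2 + i)

  F-inflationary : ∀ e i → i < F e i
  F-inflationary zero    i = ≤-refl
  F-inflationary (suc e) i = fold-inflationary (λ x → <⇒≤ (F-inflationary e x)) (2 + i)

  F-≤ : ∀ e i → i ≤ F e i
  F-≤ e i = <⇒≤ (F-inflationary e i)

  F-monoʳ : ∀ e {i j} → i ≤ j → F e i ≤ F e j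
  F-monoʳ zero        i≤j = s≤s i≤j
  F-monoʳ (suc e) {i} i≤j = ≤-trans (fold-mono (F-monoʳ e) (2 + i) (s≤s i≤j))
                                    (fold-monoʳ (F-≤ e) (+-monoʳ-≤ 2 i≤j))

  F∘F≤F : ∀ e i → F e (F e i) ≤ F (suc e) i
  F∘F≤F e i = ≤-trans (fold-mono (F-monoʳ e) 2 (n≤1+n i)) (fold-monoʳ (F-≤ e) (m≤m+n 2 i))

  F-monoˡ : ∀ {d e} → d ≤ e → ∀ i → F d i ≤ F e i
  F-monoˡ d≤e i = go (≤⇒≤′ d≤e)
    where
    go : ∀ {d e} → d ≤′ e → F d i ≤ F e i
    go (≤′-reflexive refl) = ≤-refl
    go (≤′-step {e} d≤′e)  = ≤-trans (≤-trans (go d≤′e) (F-≤ e _)) (F∘F≤F e i)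

  F-mono : ∀ {d e i j} → d ≤ e → i ≤ j → F d i ≤ F e j
  F-mono {d} d≤e i≤j = ≤-trans (F-monoʳ d i≤j) (F-monoˡ d≤e _)

  F-comp : ∀ d e i → F d (F e i) ≤ F (suc (d ⊔ e)) i
  F-comp d e i = ≤-trans (F-mono (m≤m⊔n d e) (F-monoˡ (m≤n⊔m d e) i)) (F∘F≤F (d ⊔ e) i)

  -- Each level iterates the previous one: with increments of 1 this yields addition at `F 1`, and
  -- with increments of `m`, supplied by `F 1`, multiplication at `F 2`.
  m+n≤fold : ∀ {f m} → (∀ {x} → m ≤ x → x + m ≤ f x) → ∀ n {x} → m ≤ x → x + n * m ≤ fold x f n
  m+n≤fold {f} {m} step zero    {x} m≤x = ≤-reflexive (+-identityʳ x)
  m+n≤fold {f} {m} step (suc n) {x} m≤x = begin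
    x + (m + n * m)  ≡⟨ lemma x m (n * m) ⟩
    x + n * m + m    ≤⟨ +-monoˡ-≤ m ih ⟩
    fold x f n + m   ≤⟨ step (≤-trans m≤x (≤-trans (m≤m+n x _) ih)) ⟩
    f (fold x f n)   ∎
    where
    open ≤-Reasoning
    ih = m+n≤fold step n m≤x
    lemma : ∀ x m y → x + (m + y) ≡ x + y + m
    lemma = solve-∀

  n+m≤F₁ : ∀ {m} n → m ≤ n → n + m ≤ F 1 n
  n+m≤F₁ {m} n m≤n = begin
    n + m                ≤⟨ +-mono-≤ (n≤1+n n) (≤-trans m≤n (m≤n+m n 2)) ⟩
    suc n + (2 + n)      ≡⟨ cong (suc n +_) (*-identityʳ (2 + n)) ⟨
    suc n + (2 + n) * 1  ≤⟨ m+n≤fold (λ {x} _ → ≤-reflexive (+-comm x 1)) (2 + n) (s≤s z≤n) ⟩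
    F 1 n                ∎
    where open ≤-Reasoning

  m*m≤F₂ : ∀ m → m * m ≤ F 2 m
  m*m≤F₂ m = begin
    m * m                ≤⟨ *-monoˡ-≤ m (m≤n+m m 2) ⟩
    (2 + m) * m          ≤⟨ m≤n+m _ (suc m) ⟩
    suc m + (2 + m) * m  ≤⟨ m+n≤fold (n+m≤F₁ _) (2 + m) (n≤1+n m) ⟩
    F 2 m                ∎
    where open ≤-Reasoning

  -- Raising the level by one allows one further application of `F (2 + e)`, which dominates `F 1`
  -- and therefore doubling.
  2^≤F : ∀ e → 2 ^ (4 + e) ≤ F (2 + e) 1
  -- `F 2 1` evaluates to 37 = 16 + 21.
  2^≤F zero    = m≤m+n 16 21
  2^≤F (suc e) = begin
    2 * 2 ^ (4 + e)              ≡⟨ cong (2 ^ (4 + e) +_) (+-identityʳ _) ⟩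
    2 ^ (4 + e) + 2 ^ (4 + e)    ≤⟨ +-mono-≤ (2^≤F e) (2^≤F e) ⟩
    F (2 + e) 1 + F (2 + e) 1    ≤⟨ n+m≤F₁ (F (2 + e) 1) ≤-refl ⟩
    F 1 (F (2 + e) 1)            ≤⟨ F-monoˡ {1} {2 + e} (s≤s z≤n) (F (2 + e) 1) ⟩
    F (2 + e) (F (2 + e) 1)      ≤⟨ F∘F≤F (2 + e) 1 ⟩
    F (3 + e) 1                  ∎
    where open ≤-Reasoning

  -- `F (3 + e) 0` unfolds to two applications of `F (2 + e)` to 1: the inner one exceeds the power
  -- of 2, the outer one dominates `F e`.
  F-diagonal : ∀ e → F e (2 ^ (4 + e)) ≤ F (3 + e) 0
  F-diagonal e = ≤-trans (F-mono (m≤n+m e 2) (2^≤F e)) (≤-refl {F (2 + e) (F (2 + e) 1)})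

  -- Normal forms and change of base

  Decreasing : Expansion → Set
  Decreasing = AllPairs (λ s t → proj₁ s > proj₁ t)

  Coefficients : ℕ → Expansion → Set
  Coefficients b = All (λ t → 0 < proj₂ t × proj₂ t < b)

  lead≤ : ∀ b e {c} p → .{{NonZero b}} → 0 < c → b ^ e ≤ eval b ((e , c) ∷ p)
  lead≤ b e {c} p 0<c = ≤-trans (m≤m*n (b ^ e) c {{>-nonZero 0<c}}) (m≤m+n _ (eval b p))

  eval-< : ∀ {b e p} → .{{NonZero b}} → Decreasing p → Coefficients b p →
           All (λ t → proj₁ t < e) p → eval b p < b ^ e
  eval-<cons : ∀ {b e c p} → .{{NonZero b}} → Decreasing ((e , c) ∷ p) →
               Coefficients b ((e , c) ∷ p) → eval b ((e , c) ∷ p) < b ^ e * suc c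

  eval-< {b} {e} [] [] [] = m^n>0 b e
  eval-< {b} {e} {(d , c) ∷ p} dec coe@((_ , c<b) ∷ _) (d<e ∷ _) = begin-strict
    eval b ((d , c) ∷ p)  <⟨ eval-<cons dec coe ⟩
    b ^ d * suc c         ≤⟨ *-monoʳ-≤ (b ^ d) c<b ⟩
    b ^ d * b             ≡⟨ *-comm (b ^ d) b ⟩
    b ^ suc d             ≤⟨ ^-monoʳ-≤ b d<e ⟩
    b ^ e                 ∎
    where open ≤-Reasoning
  eval-<cons {b} {e} {c} {p} (d ∷ dec) (_ ∷ coe) = begin-strict
    b ^ e * c + eval b p  <⟨ +-monoʳ-< (b ^ e * c) (eval-< dec coe d) ⟩
    b ^ e * c + b ^ e     ≡⟨ +-comm (b ^ e * c) (b ^ e) ⟩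
    b ^ e + b ^ e * c     ≡⟨ *-suc (b ^ e) c ⟨
    b ^ e * suc c         ∎
    where open ≤-Reasoning

  -- Normal forms are ordered lexicographically, whatever the base.

  module _ {b b′ : ℕ} .{{_ : NonZero b}} .{{_ : NonZero b′}} where

    eval-mono-< : ∀ {p q} → Decreasing p → Decreasing q →
                  Coefficients b p → Coefficients b q → Coefficients b′ p → Coefficients b′ q →
                  eval b p < eval b q → eval b′ p < eval b′ q
    eval-mono-< {[]}          {(e , _) ∷ q} _ _ _ _ _ ((0<c , _) ∷ _) _ =
      <-≤-trans (m^n>0 b′ e) (lead≤ b′ e q 0<c)
    eval-mono-< {(e , c) ∷ p} {(e′ , c′) ∷ q} dp@(d ∷ dp′) dq@(d′ ∷ dq′)
                cp@((0<c , c<b) ∷ cp′) cq@((0<c′ , c′<b) ∷ cq′)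
                bp@((_ , c<b′) ∷ bp′) bq@((_ , c′<b′) ∷ bq′) p<q with <-cmp e e′
    ... | tri< e<e′ _ _ =
      <-≤-trans (eval-< dp bp (e<e′ ∷ All.map (λ x → <-trans x e<e′) d)) (lead≤ b′ e′ q 0<c′)
    ... | tri> _ _ e′<e = contradiction
      (<-≤-trans (eval-< dq cq (e′<e ∷ All.map (λ x → <-trans x e′<e) d′)) (lead≤ b e p 0<c))
      (<-asym p<q)
    ... | tri≈ _ refl _ with <-cmp c c′
    ...   | tri< c<c′ _ _ = <-≤-trans (eval-<cons dp bp)
      (≤-trans (*-monoʳ-≤ (b′ ^ e) c<c′) (m≤m+n _ (eval b′ q)))
    ...   | tri> _ _ c′<c = contradiction
      (<-≤-trans (eval-<cons dq cq) (≤-trans (*-monoʳ-≤ (b ^ e) c′<c) (m≤m+n _ (eval b p))))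
      (<-asym p<q)
    ...   | tri≈ _ refl _ = +-monoʳ-< (b′ ^ e * c)
      (eval-mono-< dp′ dq′ cp′ cq′ bp′ bq′ (+-cancelˡ-< (b ^ e * c) _ _ p<q))

  -- The base change, without the subtraction of 1, at time i.

  rebase : ℕ → ℕ → ℕ
  rebase i n = eval (3 + i) (proj₁ (normalForm (2 + i) n))

  G-suc : ∀ n i → G n (suc i) ≡ rebase i (G n i) ∸ 1
  G-suc n i with G n i
  ... | zero  = refl
  ... | suc _ = refl

  weaken-coefficients : ∀ {b p} → Coefficients b p → Coefficients (suc b) p
  weaken-coefficients = All.map (λ (0<c , c<b) → 0<c , m≤n⇒m≤1+n c<b)

  -- By contraposition, comparing expansions from base 3 + i back to base 2 + i. Since `p` may be
  -- any normal form of `m`, uniqueness of normal forms never has to be proved.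
  rebase-NF : ∀ {i m n p} → m =[ 2 + i ]NF p → m ≤ n → eval (3 + i) p ≤ rebase i n
  rebase-NF {i} {m} {n} {p} (mkNF refl dp cp) m≤n with normalForm (2 + i) n
  ... | q , mkNF refl dq cq = ≮⇒≥ λ q<p → <⇒≱
    (eval-mono-< {3 + i} {2 + i} dq dp (weaken-coefficients cq) (weaken-coefficients cp) cq cp q<p) m≤n

  rebase-mono-< : ∀ i m n → m < n → rebase i m < rebase i n
  rebase-mono-< i m n m<n with normalForm (2 + i) m | normalForm (2 + i) n
  ... | p , mkNF refl dp cp | q , mkNF refl dq cq =
    eval-mono-< {2 + i} {3 + i} dp dq cp cq (weaken-coefficients cp) (weaken-coefficients cq) m<n

  rebase-mono-≤ : ∀ i m n → m ≤ n → rebase i m ≤ rebase i n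
  rebase-mono-≤ i m n = rebase-NF (proj₂ (normalForm (2 + i) m))

  rebase-+ : ∀ i j m → j + rebase i m ≤ rebase i (j + m)
  rebase-+ i zero    m = ≤-refl
  rebase-+ i (suc j) m = ≤-<-trans (rebase-+ i j m) (rebase-mono-< i (j + m) (suc j + m) ≤-refl)

  raise : ℕ × ℕ → ℕ × ℕ
  raise (e , c) = suc e , c

  eval-raise : ∀ b p → eval b (map raise p) ≡ b * eval b p
  eval-raise b []            = sym (*-zeroʳ b)
  eval-raise b ((e , c) ∷ p) rewrite eval-raise b p = lemma b (b ^ e) c (eval b p)
    where
    lemma : ∀ b q c r → b * q * c + b * r ≡ b * (q * c + r)
    lemma = solve-∀

  -- Multiplying by the base raises every exponent by one, and the raised expansion is again a
  -- normal form.
  rebase-* : ∀ i m → (3 + i) * rebase i m ≤ rebase i ((2 + i) * m)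
  rebase-* i m with normalForm (2 + i) m
  ... | p , mkNF refl dp cp = subst (_≤ rebase i ((2 + i) * eval (2 + i) p)) (eval-raise (3 + i) p)
    (rebase-NF (mkNF (sym (eval-raise (2 + i) p))
                     (AllPairs.map⁺ (AllPairs.map s<s dp)) (All.map⁺ cp)) ≤-refl)

  rebase-^ : ∀ i e m → (3 + i) ^ e * rebase i m ≤ rebase i ((2 + i) ^ e * m)
  rebase-^ i zero    m = ≤-reflexive (trans (*-identityˡ (rebase i m)) (cong (rebase i) (sym (*-identityˡ m))))
  rebase-^ i (suc e) m = begin
    (3 + i) ^ suc e * rebase i m             ≡⟨ *-assoc (3 + i) ((3 + i) ^ e) (rebase i m) ⟩
    (3 + i) * ((3 + i) ^ e * rebase i m)     ≤⟨ *-monoʳ-≤ (3 + i) (rebase-^ i e m) ⟩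
    (3 + i) * rebase i ((2 + i) ^ e * m)     ≤⟨ rebase-* i ((2 + i) ^ e * m) ⟩
    rebase i ((2 + i) * ((2 + i) ^ e * m))   ≡⟨ cong (rebase i) (*-assoc (2 + i) ((2 + i) ^ e) m) ⟨
    rebase i ((2 + i) ^ suc e * m)           ∎
    where open ≤-Reasoning

  -- Lower bounds for Goodstein sequences

  -- m i stands for the part of a Goodstein sequence that only undergoes base changes.

  Rebasing : (ℕ → ℕ) → Set
  Rebasing m = ∀ i → m (suc i) ≤ rebase i (m i)

  -- Appends `j` as the lowest digit below those of `m i` in the current base 2 + i.
  _∙base+_ : (ℕ → ℕ) → ℕ → ℕ → ℕ
  (m ∙base+ j) i = j + (2 + i) * m i

  Rebasing-digit : ∀ {m} j → Rebasing m → Rebasing (m ∙base+ j)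
  Rebasing-digit {m} j reb i = begin
    j + (3 + i) * m (suc i)         ≤⟨ +-monoʳ-≤ j (*-monoʳ-≤ (3 + i) (reb i)) ⟩
    j + (3 + i) * rebase i (m i)    ≤⟨ +-monoʳ-≤ j (rebase-* i (m i)) ⟩
    j + rebase i ((2 + i) * m i)    ≤⟨ rebase-+ i j ((2 + i) * m i) ⟩
    rebase i (j + (2 + i) * m i)    ∎
    where open ≤-Reasoning

  G-step : ∀ n i e m → (2 + i) ^ e * suc m ≤ G n i → (3 + i) ^ e * suc (rebase i m) ≤ suc (G n (suc i))
  G-step n i e m le = begin
    (3 + i) ^ e * suc (rebase i m)   ≤⟨ *-monoʳ-≤ ((3 + i) ^ e) (rebase-mono-< i m (suc m) ≤-refl) ⟩
    (3 + i) ^ e * rebase i (suc m)   ≤⟨ rebase-^ i e (suc m) ⟩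
    rebase i ((2 + i) ^ e * suc m)   ≤⟨ rebase-mono-≤ i ((2 + i) ^ e * suc m) (G n i) le ⟩
    rebase i (G n i)                 ≤⟨ m≤n+m∸n _ 1 ⟩
    suc (rebase i (G n i) ∸ 1)       ≡⟨ cong suc (G-suc n i) ⟨
    suc (G n (suc i))                ∎
    where open ≤-Reasoning

  -- One copy of bᵉ is spent while `m` is merely rebased. For `suc e`, the first step breaks the
  -- copy of bᵉ⁺¹ into copies of (b + 1)ᵉ. These are spent one after another by the induction
  -- hypothesis; the copies still waiting form an extra lowest digit of `m`.
  G-lower : ∀ n e {m} → Rebasing m → ∀ i →
            (2 + i) ^ e * suc (m i) ≤ G n i → (2 + F e i) ^ e * m (F e i) ≤ G n (F e i)
  G-lower n zero    {m} reb i le = s≤s⁻¹ (begin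
    suc (1 * m (suc i))      ≡⟨ cong suc (*-identityˡ _) ⟩
    suc (m (suc i))          ≤⟨ s≤s (reb i) ⟩
    suc (rebase i (m i))     ≡⟨ *-identityˡ _ ⟨
    1 * suc (rebase i (m i)) ≤⟨ G-step n i 0 (m i) le ⟩
    suc (G n (suc i))        ∎)
    where open ≤-Reasoning
  G-lower n (suc e) {m} reb i le = begin
    b * b ^ e * m j     ≡⟨ assoc b (b ^ e) (m j) ⟩
    b ^ e * (b * m j)   ≤⟨ digits (2 + i) 0 digit-split ⟩
    G n j               ∎
    where
    open ≤-Reasoning
    j = F (suc e) i
    b = 2 + j

    assoc : ∀ b q m → b * q * m ≡ q * (b * m)
    assoc = solve-∀

    -- `s` counts the copies already spent and `d` those remaining. The sum is the number at time
    -- `suc i`, so the recursion trades one for the other.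
    digits : ∀ s d → (3 + i) ^ e * (m ∙base+ (s + d)) (suc i) ≤ G n (suc i) →
             let k = fold (suc i) (F e) s in (2 + k) ^ e * (m ∙base+ d) k ≤ G n k
    digits zero    d le = le
    digits (suc s) d le = G-lower n e {m ∙base+ d} (Rebasing-digit {m} d reb) (fold (suc i) (F e) s)
      (digits s (suc d) (subst (λ x → (3 + i) ^ e * (m ∙base+ x) (suc i) ≤ G n (suc i)) (sym (+-suc s d)) le))

    shape : ∀ i q m → (3 + i) * q * suc m ≡ q + q * ((2 + i) + 0 + (3 + i) * m)
    shape = solve-∀

    -- Of the 3 + i copies of (3 + i)ᵉ, one absorbs the subtraction of 1; whatever is left of that
    -- copy is discarded.
    digit-split : (3 + i) ^ e * (m ∙base+ (2 + i + 0)) (suc i) ≤ G n (suc i)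
    digit-split = s≤s⁻¹ (begin
      suc (q * ((2 + i) + 0 + (3 + i) * m (suc i)))  ≤⟨ +-monoˡ-≤ _ (m^n>0 (3 + i) e) ⟩
      q + q * ((2 + i) + 0 + (3 + i) * m (suc i))    ≡⟨ shape i q (m (suc i)) ⟨
      (3 + i) * q * suc (m (suc i))                  ≤⟨ *-monoʳ-≤ ((3 + i) * q) (s≤s (reb i)) ⟩
      (3 + i) ^ suc e * suc (rebase i (m i))         ≤⟨ G-step n i (suc e) (m i) le ⟩
      suc (G n (suc i))                              ∎)
      where q = (3 + i) ^ e

  G-stays-0 : ∀ n i d → G n i ≡ 0 → G n (d + i) ≡ 0
  G-stays-0 n i zero    eq = eq
  G-stays-0 n i (suc d) eq rewrite G-stays-0 n i d eq = refl

  -- The start value is 2ᵉ · suc 1, so one copy of 2ᵉ can be spent while a rebased part 1 survives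
  -- and keeps the value positive.
  G≡0⇒F< : ∀ e {i} → G (2 ^ suc e) i ≡ 0 → F e 0 < i
  G≡0⇒F< e {i} Gi≡0 = ≰⇒> λ i≤F → <⇒≱ positive (≤-reflexive
    (subst (λ j → G (2 ^ suc e) j ≡ 0) (m∸n+n≡m i≤F) (G-stays-0 _ i (F e 0 ∸ i) Gi≡0)))
    where
    open ≤-Reasoning
    rebase-1 : Rebasing (λ _ → 1)
    rebase-1 i = rebase-mono-< i 0 1 ≤-refl

    positive : 0 < G (2 ^ suc e) (F e 0)
    positive = begin-strict
      0                       <⟨ m^n>0 (2 + F e 0) e ⟩
      (2 + F e 0) ^ e         ≡⟨ *-identityʳ _ ⟨
      (2 + F e 0) ^ e * 1     ≤⟨ G-lower _ e rebase-1 0 (≤-reflexive (*-comm (2 ^ e) 2)) ⟩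
      G (2 ^ suc e) (F e 0)   ∎

open GoodsteinGrowth

-- Worlds and collapse

module Forcing where

  open import Data.List using (List; []; _∷_)
  open import Data.List.Relation.Unary.All as All using (All; []; _∷_)
  import Data.List.Relation.Unary.All.Properties as All
  open import Data.Vec.Functional using () renaming (_∷_ to _∷ᶠ_)

  private
    variable
      m n : ℕ

  -- A family of intervals [lo x , hi x], each approximating a cut that contains lo x but not
  -- hi x and is closed under all F k. It collapses, i.e. forces falsity, if one F k leads out
  -- of all its intervals.

  record World : Set₁ where
    field
      Index : Set
      lo hi : Index → ℕ

  open World

  record Collapses (w : World) : Set where
    constructor collapse
    field
      level : ℕ
      hi-<  : ∀ x → hi w x < F level (lo w x)

  infix 4 _≼ʷ_

  -- Intervals of `w` may be shrunk, dropped or repeated. Repetition allows an index to carry extra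
  -- data, such as a counterexample or a subinterval.
  record _≼ʷ_ (v w : World) : Set where
    field
      reindex : Index v → Index w
      lo-≤    : ∀ x → lo w (reindex x) ≤ lo v x
      hi-≥    : ∀ x → hi v x ≤ hi w (reindex x)

  open _≼ʷ_

  ≼ʷ-refl : ∀ {w} → w ≼ʷ w
  ≼ʷ-refl = record { reindex = id ; lo-≤ = λ _ → ≤-refl ; hi-≥ = λ _ → ≤-refl }

  ≼ʷ-trans : ∀ {u v w} → u ≼ʷ v → v ≼ʷ w → u ≼ʷ w
  ≼ʷ-trans r s = record
    { reindex = λ x → reindex s (reindex r x)
    ; lo-≤    = λ x → ≤-trans (lo-≤ s _) (lo-≤ r x)
    ; hi-≥    = λ x → ≤-trans (hi-≥ r x) (hi-≥ s _)
    }

  restrict : (w : World) → (Index w → Set) → World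
  restrict w P = record { Index = Σ (Index w) P ; lo = lo w ∘ proj₁ ; hi = hi w ∘ proj₁ }

  restrict-≼ : ∀ {w} P → restrict w P ≼ʷ w
  restrict-≼ P = record { reindex = proj₁ ; lo-≤ = λ _ → ≤-refl ; hi-≥ = λ _ → ≤-refl }

  collapses-empty : ∀ {w} → ¬ Index w → Collapses w
  collapses-empty empty = collapse 0 λ x → contradiction x empty

  -- The larger of the two levels serves both parts, so the collapsing parts of a world behave like
  -- an ideal.
  collapses-⊎ : ∀ {w P R} → Collapses (restrict w P) → Collapses (restrict w R) →
                Collapses (restrict w λ x → P x ⊎ R x)
  collapses-⊎ {w} (collapse k hi<) (collapse l hi<′) = collapse (k ⊔ l) λ where
    (x , inj₁ p) → <-≤-trans (hi< (x , p)) (F-monoˡ (m≤m⊔n k l) (lo w x))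
    (x , inj₂ r) → <-≤-trans (hi<′ (x , r)) (F-monoˡ (m≤n⊔m k l) (lo w x))

  -- The level is fixed before any index is inspected, and the remaining inequality is decidable,
  -- hence stable under double negation.
  collapses-¬¬ : ∀ {w P} → (∀ x → ¬ ¬ P x) → Collapses (restrict w P) → Collapses w
  collapses-¬¬ {w} ¬¬p (collapse k hi<) = collapse k λ x →
    decidable-stable (hi w x <? F k (lo w x)) λ hi≮ → ¬¬p x λ p → hi≮ (hi< (x , p))

  collapses-em : ∀ {w P} → Collapses (restrict w P) → Collapses (restrict w (¬_ ∘ P)) → Collapses w
  collapses-em c c′ = collapses-¬¬ (λ x ¬em → ¬em (inj₂ (¬em ∘ inj₁))) (collapses-⊎ c c′)

  -- Names for elements of the cut

  -- With one level for all indices, `e x` lies in every cut that contains `lo w x` and is closed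
  -- under all `F k`.
  record Controlled (w : World) (e : Index w → ℕ) : Set where
    constructor control
    field
      level : ℕ
      ≤-F   : ∀ x → e x ≤ F level (lo w x)

  controlled-mono : ∀ {v w e} (r : v ≼ʷ w) → Controlled w e → Controlled v (e ∘ reindex r)
  controlled-mono r (control k e≤) = control k λ x → ≤-trans (e≤ _) (F-monoʳ k (lo-≤ r x))

  controlled-≤ : ∀ {w d e} → (∀ x → d x ≤ e x) → Controlled w e → Controlled w d
  controlled-≤ d≤e (control k e≤) = control k λ x → ≤-trans (d≤e x) (e≤ x)

  controlled-F : ∀ {w e} d → Controlled w e → Controlled w (F d ∘ e)
  controlled-F {w} d (control k e≤) = control (suc (d ⊔ k)) λ x → ≤-trans (F-monoʳ d (e≤ x)) (F-comp d k (lo w x))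

  controlled-⊔ : ∀ {w d e} → Controlled w d → Controlled w e → Controlled w (λ x → d x ⊔ e x)
  controlled-⊔ {w} (control k d≤) (control l e≤) = control (k ⊔ l) λ x →
    ⊔-lub (≤-trans (d≤ x) (F-monoˡ (m≤m⊔n k l) (lo w x)))
          (≤-trans (e≤ x) (F-monoˡ (m≤n⊔m k l) (lo w x)))

  Env : World → ℕ → Set
  Env w n = Index w → Vector ℕ n

  ControlledEnv : (w : World) → Env w n → Set
  ControlledEnv w ρ = ∀ i → Controlled w (λ x → ρ x i)

  extend : {I : Set} → (I → ℕ) → (I → Vector ℕ n) → I → Vector ℕ (suc n)
  extend e ρ x = e x ∷ᶠ ρ x

  controlled-extend : ∀ {w e} {ρ : Env w n} → Controlled w e → ControlledEnv w ρ →
                      ControlledEnv w (extend e ρ)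
  controlled-extend ce cρ zero    = ce
  controlled-extend ce cρ (suc i) = cρ i

  controlled-reindex : ∀ {v w} {ρ : Env w n} (r : v ≼ʷ w) → ControlledEnv w ρ →
                       ControlledEnv v (ρ ∘ reindex r)
  controlled-reindex r cρ i = controlled-mono r (cρ i)

  controlled-term : ∀ {w} {ρ : Env w n} → ControlledEnv w ρ → ∀ t → Controlled w (λ x → ⟦ t ⟧ (ρ x))
  controlled-term cρ (var i) = cρ i
  controlled-term cρ `0      = control 0 λ _ → z≤n
  controlled-term cρ (`S t)  = controlled-F 0 (controlled-term cρ t)
  controlled-term {ρ = ρ} cρ (s ⊕ t) = controlled-≤
    (λ x → let y = ⟦ s ⟧ (ρ x) ; z = ⟦ t ⟧ (ρ x) in
      ≤-trans (+-mono-≤ (m≤m⊔n y z) (m≤n⊔m y z)) (n+m≤F₁ (y ⊔ z) ≤-refl))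
    (controlled-F 1 (controlled-⊔ (controlled-term cρ s) (controlled-term cρ t)))
  controlled-term {ρ = ρ} cρ (s ⊗ t) = controlled-≤
    (λ x → let y = ⟦ s ⟧ (ρ x) ; z = ⟦ t ⟧ (ρ x) in
      ≤-trans (*-mono-≤ (m≤m⊔n y z) (m≤n⊔m y z)) (m*m≤F₂ (y ⊔ z)))
    (controlled-F 2 (controlled-⊔ (controlled-term cρ s) (controlled-term cρ t)))

  -- The forcing relation

  infix 1 _,_⊩_ _,_⊮_

  -- w , ρ ⊮ φ says that w forces the negation of φ, not that it fails to force φ.

  _,_⊩_ _,_⊮_ : (w : World) → Env w n → Formula n → Set₁

  w , ρ ⊩ pos a    = ∀ {v} (r : v ≼ʷ w) → (∀ x → ¬ (ℕ⊨ᵃ[ ρ (reindex r x) ] a)) → Collapses v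
  w , ρ ⊩ neg a    = ∀ {v} (r : v ≼ʷ w) → (∀ x → ℕ⊨ᵃ[ ρ (reindex r x) ] a) → Collapses v
  w , ρ ⊩ (φ `∧ ψ) = (w , ρ ⊩ φ) × (w , ρ ⊩ ψ)
  w , ρ ⊩ (φ `∨ ψ) = ∀ {v} (r : v ≼ʷ w) → v , ρ ∘ reindex r ⊮ φ → v , ρ ∘ reindex r ⊮ ψ → Collapses v
  w , ρ ⊩ `∀ φ     = ∀ {v} (r : v ≼ʷ w) {e} → Controlled v e → v , extend e (ρ ∘ reindex r) ⊩ φ
  w , ρ ⊩ `∃ φ     = ∀ {v} (r : v ≼ʷ w) →
    (∀ {u} (s : u ≼ʷ v) {e} → Controlled u e → u , extend e (ρ ∘ reindex r ∘ reindex s) ⊮ φ) →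
    Collapses v

  w , ρ ⊮ φ = ∀ {v} (r : v ≼ʷ w) → v , ρ ∘ reindex r ⊩ φ → Collapses v

  ⊩-mono : ∀ (φ : Formula n) {v w ρ} (r : v ≼ʷ w) → w , ρ ⊩ φ → v , ρ ∘ reindex r ⊩ φ
  ⊩-mono (pos a)  r f = λ s → f (≼ʷ-trans s r)
  ⊩-mono (neg a)  r f = λ s → f (≼ʷ-trans s r)
  ⊩-mono (φ `∧ ψ) r (f , g) = ⊩-mono φ r f , ⊩-mono ψ r g
  ⊩-mono (φ `∨ ψ) r f = λ s → f (≼ʷ-trans s r)
  ⊩-mono (`∀ φ)   r f = λ s → f (≼ʷ-trans s r)
  ⊩-mono (`∃ φ)   r f = λ s → f (≼ʷ-trans s r)

  -- The clauses for literals, disjunctions and existential quantifiers are themselves refutations,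
  -- with collapse as falsity, so double negations cancel there; conjunctions and universal
  -- quantifiers inherit stability.
  ⊩-stable : ∀ (φ : Formula n) {w ρ} →
             (∀ {v} (r : v ≼ʷ w) → v , ρ ∘ reindex r ⊮ φ → Collapses v) → w , ρ ⊩ φ
  ⊩-stable (pos a)  f r ⊭a = f r λ s p → p ≼ʷ-refl (⊭a ∘ reindex s)
  ⊩-stable (neg a)  f r ⊨a = f r λ s p → p ≼ʷ-refl (⊨a ∘ reindex s)
  ⊩-stable (φ `∧ ψ) f = ⊩-stable φ (λ r g → f r λ s (p , q) → g s p)
                      , ⊩-stable ψ (λ r g → f r λ s (p , q) → g s q)
  ⊩-stable (φ `∨ ψ) f r g h = f r λ s p → p ≼ʷ-refl (λ t → g (≼ʷ-trans t s)) (λ t → h (≼ʷ-trans t s))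
  ⊩-stable (`∀ φ) {w} {ρ} f r {e} ce = ⊩-stable φ λ s g → f (≼ʷ-trans s r) λ t p →
    g t (p ≼ʷ-refl {e ∘ reindex s ∘ reindex t} (controlled-mono t (controlled-mono s ce)))
  ⊩-stable (`∃ φ)   f r g = f r λ s p → p ≼ʷ-refl λ t → g (≼ʷ-trans t s)

  -- Since `∼` is the de Morgan dual, its agreement with refutation needs proof. At an atom the
  -- world is split by truth at each index, and either part collapses.
  ⊩-consistent : ∀ (φ : Formula n) {w ρ} → w , ρ ⊩ φ → w , ρ ⊩ ∼ φ → Collapses w
  ⊩-consistent (pos a) {w} {ρ} p q = collapses-em {P = λ x → ℕ⊨ᵃ[ ρ x ] a}
    (q (restrict-≼ _) proj₂) (p (restrict-≼ _) proj₂)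
  ⊩-consistent (neg a) {w} {ρ} p q = collapses-em {P = λ x → ℕ⊨ᵃ[ ρ x ] a}
    (p (restrict-≼ _) proj₂) (q (restrict-≼ _) proj₂)
  ⊩-consistent (φ `∧ ψ) (p , q) f = f ≼ʷ-refl (λ r → ⊩-consistent φ (⊩-mono φ r p))
                                              (λ r → ⊩-consistent ψ (⊩-mono ψ r q))
  ⊩-consistent (φ `∨ ψ) f (p , q) = f ≼ʷ-refl (λ r g → ⊩-consistent φ g (⊩-mono (∼ φ) r p))
                                              (λ r g → ⊩-consistent ψ g (⊩-mono (∼ ψ) r q))
  ⊩-consistent (`∀ φ) f g = g ≼ʷ-refl λ s ce t p →
    ⊩-consistent φ (f (≼ʷ-trans t s) (controlled-mono t ce)) p
  ⊩-consistent (`∃ φ) f g = f ≼ʷ-refl λ s ce t p →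
    ⊩-consistent φ p (g (≼ʷ-trans t s) (controlled-mono t ce))

  -- The other half of that agreement: together with stability, refuting `φ` yields forcing of
  -- `∼ φ`.
  ⊩-excluded-middle : ∀ (φ : Formula n) {w} ρ → w , ρ ⊮ φ → w , ρ ⊮ ∼ φ → Collapses w
  ⊩-excluded-middle (pos a) ρ f g = collapses-em {P = λ x → ℕ⊨ᵃ[ ρ x ] a}
    (f (restrict-≼ _) λ r ⊭a → collapses-empty λ x → ⊭a x (proj₂ (reindex r x)))
    (g (restrict-≼ _) λ r ⊨a → collapses-empty λ x → proj₂ (reindex r x) (⊨a x))
  ⊩-excluded-middle (neg a) ρ f g = collapses-em {P = λ x → ℕ⊨ᵃ[ ρ x ] a}
    (g (restrict-≼ _) λ r ⊭a → collapses-empty λ x → ⊭a x (proj₂ (reindex r x)))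
    (f (restrict-≼ _) λ r ⊨a → collapses-empty λ x → proj₂ (reindex r x) (⊨a x))
  ⊩-excluded-middle (φ `∧ ψ) ρ f g = ⊩-excluded-middle φ ρ
    (λ r p → ⊩-excluded-middle ψ (ρ ∘ reindex r)
      (λ s q → f (≼ʷ-trans s r) (⊩-mono φ {ρ = ρ ∘ reindex r} s p , q))
      (λ s q → g (≼ʷ-trans s r) (λ t _ h → h ≼ʷ-refl (⊩-mono (∼ ψ) {ρ = ρ ∘ reindex r ∘ reindex s} t q))))
    (λ r p → g r λ t h _ → h ≼ʷ-refl (⊩-mono (∼ φ) {ρ = ρ ∘ reindex r} t p))
  ⊩-excluded-middle (φ `∨ ψ) ρ f g = ⊩-excluded-middle φ ρ
    (λ r p → f r λ t h _ → h ≼ʷ-refl (⊩-mono φ {ρ = ρ ∘ reindex r} t p))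
    (λ r p → ⊩-excluded-middle ψ (ρ ∘ reindex r)
      (λ s q → f (≼ʷ-trans s r) (λ t _ h → h ≼ʷ-refl (⊩-mono ψ {ρ = ρ ∘ reindex r ∘ reindex s} t q)))
      (λ s q → g (≼ʷ-trans s r) (⊩-mono (∼ φ) {ρ = ρ ∘ reindex r} s p , q)))
  ⊩-excluded-middle (`∀ φ) ρ f g = f ≼ʷ-refl λ r {e} ce → ⊩-stable φ {ρ = extend e (ρ ∘ reindex r)} λ s h →
    ⊩-excluded-middle φ (extend e (ρ ∘ reindex r) ∘ reindex s) h λ t p → g (≼ʷ-trans t (≼ʷ-trans s r)) λ q k →
      k ≼ʷ-refl (controlled-mono q (controlled-mono t (controlled-mono s ce))) ≼ʷ-refl (⊩-mono (∼ φ) q p)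
  ⊩-excluded-middle (`∃ φ) ρ f g = g ≼ʷ-refl λ r {e} ce → ⊩-stable (∼ φ) {ρ = extend e (ρ ∘ reindex r)} λ s h →
    ⊩-excluded-middle φ (extend e (ρ ∘ reindex r) ∘ reindex s)
    (λ t p → f (≼ʷ-trans t (≼ʷ-trans s r)) λ q k →
      k ≼ʷ-refl (controlled-mono q (controlled-mono t (controlled-mono s ce))) ≼ʷ-refl (⊩-mono φ q p))
    h

  ⊩-⇒-intro : ∀ (φ ψ : Formula n) {w ρ} →
              (∀ {v} (r : v ≼ʷ w) → v , ρ ∘ reindex r ⊩ φ → v , ρ ∘ reindex r ⊩ ψ) → w , ρ ⊩ φ ⇒ ψ
  ⊩-⇒-intro φ ψ {ρ = ρ} imp r f g = g ≼ʷ-refl (imp r (⊩-stable φ λ s h →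
    ⊩-excluded-middle φ (ρ ∘ reindex r ∘ reindex s) h λ t → f (≼ʷ-trans t s)))

  ⊩-⇒-elim : ∀ (φ ψ : Formula n) {w ρ} → w , ρ ⊩ φ ⇒ ψ → w , ρ ⊩ φ → w , ρ ⊩ ψ
  ⊩-⇒-elim φ ψ f p = ⊩-stable ψ λ r → f r λ s → ⊩-consistent φ (⊩-mono φ (≼ʷ-trans s r) p)

  -- Substitution and soundness of the sequent calculus

  ⟦⟧-rename : ∀ (f : Fin m → Fin n) ρ t → ⟦ renameTerm f t ⟧ ρ ≡ ⟦ t ⟧ (ρ ∘ f)
  ⟦⟧-rename f ρ (var i) = refl
  ⟦⟧-rename f ρ `0      = refl
  ⟦⟧-rename f ρ (`S t)  = cong suc (⟦⟧-rename f ρ t)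
  ⟦⟧-rename f ρ (s ⊕ t) = cong₂ _+_ (⟦⟧-rename f ρ s) (⟦⟧-rename f ρ t)
  ⟦⟧-rename f ρ (s ⊗ t) = cong₂ _*_ (⟦⟧-rename f ρ s) (⟦⟧-rename f ρ t)

  Interprets : Subst m n → Vector ℕ n → Vector ℕ m → Set
  Interprets σ ρ ρ′ = ∀ i → ρ′ i ≡ ⟦ σ i ⟧ ρ

  interprets-lift : ∀ (σ : Subst m n) {ρ ρ′} a → Interprets σ ρ ρ′ →
                    Interprets (lift σ) (a ∷ᶠ ρ) (a ∷ᶠ ρ′)
  interprets-lift σ a eq zero    = refl
  interprets-lift σ {ρ} a eq (suc i) = trans (eq i) (sym (⟦⟧-rename suc (a ∷ᶠ ρ) (σ i)))

  ⟦⟧-subst : ∀ (σ : Subst m n) {ρ ρ′} → Interprets σ ρ ρ′ → ∀ t → ⟦ t ⟧ ρ′ ≡ ⟦ substTerm σ t ⟧ ρ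
  ⟦⟧-subst σ eq (var i) = eq i
  ⟦⟧-subst σ eq `0      = refl
  ⟦⟧-subst σ eq (`S t)  = cong suc (⟦⟧-subst σ eq t)
  ⟦⟧-subst σ eq (s ⊕ t) = cong₂ _+_ (⟦⟧-subst σ eq s) (⟦⟧-subst σ eq t)
  ⟦⟧-subst σ eq (s ⊗ t) = cong₂ _*_ (⟦⟧-subst σ eq s) (⟦⟧-subst σ eq t)

  ℕ⊨ᵃ-subst : ∀ (σ : Subst m n) {ρ ρ′} → Interprets σ ρ ρ′ → ∀ a →
              ℕ⊨ᵃ[ ρ′ ] a ≡ ℕ⊨ᵃ[ ρ ] substAtom σ a
  ℕ⊨ᵃ-subst σ eq (s ≐ t) = cong₂ _≡_ (⟦⟧-subst σ eq s) (⟦⟧-subst σ eq t)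
  ℕ⊨ᵃ-subst σ eq (s ≼ t) = cong₂ _≤_ (⟦⟧-subst σ eq s) (⟦⟧-subst σ eq t)

  ⊩-subst⁺ : ∀ (φ : Formula m) (σ : Subst m n) {w ρ ρ′} → (∀ x → Interprets σ (ρ x) (ρ′ x)) →
             w , ρ′ ⊩ φ → w , ρ ⊩ φ ⟪ σ ⟫
  ⊩-subst⁻ : ∀ (φ : Formula m) (σ : Subst m n) {w ρ ρ′} → (∀ x → Interprets σ (ρ x) (ρ′ x)) →
             w , ρ ⊩ φ ⟪ σ ⟫ → w , ρ′ ⊩ φ

  ⊩-subst⁺ (pos a)  σ eq f r h = f r λ x → subst ¬_ (sym (ℕ⊨ᵃ-subst σ (eq _) a)) (h x)
  ⊩-subst⁺ (neg a)  σ eq f r h = f r λ x → subst id (sym (ℕ⊨ᵃ-subst σ (eq _) a)) (h x)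
  ⊩-subst⁺ (φ `∧ ψ) σ eq (f , g) = ⊩-subst⁺ φ σ eq f , ⊩-subst⁺ ψ σ eq g
  ⊩-subst⁺ (φ `∨ ψ) σ eq f r g h = f r (λ s p → g s (⊩-subst⁺ φ σ (λ _ → eq _) p))
                                       (λ s p → h s (⊩-subst⁺ ψ σ (λ _ → eq _) p))
  ⊩-subst⁺ (`∀ φ)   σ eq f r {e} ce = ⊩-subst⁺ φ (lift σ) (λ x → interprets-lift σ (e x) (eq _)) (f r ce)
  ⊩-subst⁺ (`∃ φ)   σ eq f r g = f r λ s {e} ce t p → g s ce t
    (⊩-subst⁺ φ (lift σ) (λ x → interprets-lift σ (e (reindex t x)) (eq _)) p)

  ⊩-subst⁻ (pos a)  σ eq f r h = f r λ x → subst ¬_ (ℕ⊨ᵃ-subst σ (eq _) a) (h x)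
  ⊩-subst⁻ (neg a)  σ eq f r h = f r λ x → subst id (ℕ⊨ᵃ-subst σ (eq _) a) (h x)
  ⊩-subst⁻ (φ `∧ ψ) σ eq (f , g) = ⊩-subst⁻ φ σ eq f , ⊩-subst⁻ ψ σ eq g
  ⊩-subst⁻ (φ `∨ ψ) σ eq f r g h = f r (λ s p → g s (⊩-subst⁻ φ σ (λ _ → eq _) p))
                                       (λ s p → h s (⊩-subst⁻ ψ σ (λ _ → eq _) p))
  ⊩-subst⁻ (`∀ φ)   σ eq f r {e} ce = ⊩-subst⁻ φ (lift σ) (λ x → interprets-lift σ (e x) (eq _)) (f r ce)
  ⊩-subst⁻ (`∃ φ)   σ eq f r g = f r λ s {e} ce t p → g s ce t
    (⊩-subst⁻ φ (lift σ) (λ x → interprets-lift σ (e (reindex t x)) (eq _)) p)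

  interprets-[] : ∀ (t : Term n) ρ → Interprets (t ∷ᶠ var) ρ (⟦ t ⟧ ρ ∷ᶠ ρ)
  interprets-[] t ρ zero    = refl
  interprets-[] t ρ (suc i) = refl

  ⊮-mono : ∀ {v w} (ρ : Env w n) (r : v ≼ʷ w) {φ} → w , ρ ⊮ φ → v , ρ ∘ reindex r ⊮ φ
  ⊮-mono ρ r f s = f (≼ʷ-trans s r)

  -- Refuting every member of a derivable sequent is absurd. Environments must be controlled because
  -- the witness term in `∃-intro` has to name an element of the cut.
  soundness : ∀ {T} → (∀ {σ} → T σ → ∀ {w ρ} → w , ρ ⊩ σ) →
              ∀ {Γ : List (Formula n)} → T ⊢ˢ Γ → ∀ {w} {ρ : Env w n} → ControlledEnv w ρ →
              All (λ φ → w , ρ ⊮ φ) Γ → Collapses w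
  soundness valid (axiom {σ = σ} Tσ) cρ (f ∷ _) =
    f ≼ʷ-refl (⊩-subst⁺ σ _ {ρ′ = λ _ ()} (λ _ ()) (valid Tσ))
  soundness valid (identity {a = a}) {ρ = ρ} cρ (f ∷ g ∷ _) = ⊩-excluded-middle (pos a) ρ f g
  soundness valid (structural Γ⊆Δ d) cρ fs = soundness valid d cρ (All.anti-mono Γ⊆Δ fs)
  soundness valid (∧-intro {φ = φ} d d′) {ρ = ρ} cρ (f ∷ fs) = soundness valid d cρ
    ((λ r p → soundness valid d′ {ρ = ρ ∘ reindex r} (controlled-reindex r cρ)
      ((λ s q → f (≼ʷ-trans s r) (⊩-mono φ s p , q)) ∷ All.map (⊮-mono ρ r) fs)) ∷ fs)
  soundness valid (∨-intro {φ = φ} {ψ} d) cρ (f ∷ fs) = soundness valid d cρ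
    ( (λ r p → f r λ s g _ → g ≼ʷ-refl (⊩-mono φ s p))
    ∷ (λ r p → f r λ s _ g → g ≼ʷ-refl (⊩-mono ψ s p)) ∷ fs)
  soundness valid (∀-intro {φ = φ} d) cρ (f ∷ fs) = f ≼ʷ-refl λ r ce → ⊩-stable φ λ s g →
    soundness valid d
      (controlled-reindex s (controlled-extend ce (controlled-reindex r cρ)))
      (g ∷ All.map⁺ (All.map (λ {ψ} h {_} t p →
        h (≼ʷ-trans t (≼ʷ-trans s r)) (⊩-subst⁻ ψ _ (λ _ _ → refl) p)) fs))
  soundness valid (∃-intro {φ = φ} t d) {ρ = ρ} cρ (f ∷ fs) = soundness valid d cρ
    ((λ r p → f r λ s g → g ≼ʷ-refl (controlled-term (controlled-reindex s (controlled-reindex r cρ)) t)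
      ≼ʷ-refl (⊩-subst⁻ φ _ (λ _ → interprets-[] t _) (⊩-mono (φ [ t ]) s p))) ∷ fs)
  soundness valid (cut {φ = φ} d d′) {ρ = ρ} cρ fs = soundness valid d cρ
    ((λ r p → soundness valid d′ {ρ = ρ ∘ reindex r} (controlled-reindex r cρ)
      ((λ s q → ⊩-consistent φ (⊩-mono φ s p) q) ∷ All.map (⊮-mono ρ r) fs)) ∷ fs)

  -- Forcing compared with truth

  x≤⟦⟧-weaken : ∀ {t : Term n} {ρ y} → y ≤ ⟦ t ⟧ ρ → y ≤ ⟦ renameTerm suc t ⟧ (y ∷ᶠ ρ)
  x≤⟦⟧-weaken {t = t} {ρ} {y} = subst (y ≤_) (sym (⟦⟧-rename suc (y ∷ᶠ ρ) t))

  x≤⟦⟧-strengthen : ∀ {t : Term n} {ρ y} → y ≤ ⟦ renameTerm suc t ⟧ (y ∷ᶠ ρ) → y ≤ ⟦ t ⟧ ρ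
  x≤⟦⟧-strengthen {t = t} {ρ} {y} = subst (y ≤_) (⟦⟧-rename suc (y ∷ᶠ ρ) t)

  -- Unlike in a bounded formula, the bound on an existential quantifier need not be syntactic:
  -- this covers the axioms ≠0-def and ≼-def of Q.

  data IsΠ {n : ℕ} : Formula n → Set where
    pos  : ∀ a → IsΠ (pos a)
    neg  : ∀ a → IsΠ (neg a)
    _`∧_ : ∀ {φ ψ} → IsΠ φ → IsΠ ψ → IsΠ (φ `∧ ψ)
    _`∨_ : ∀ {φ ψ} → IsΠ φ → IsΠ ψ → IsΠ (φ `∨ ψ)
    `∀   : ∀ {φ} → IsΠ φ → IsΠ (`∀ φ)
    `∃≤  : ∀ t {φ} → (∀ ρ y → ℕ⊨[ y ∷ᶠ ρ ] φ → y ≤ ⟦ t ⟧ ρ) → IsΠ φ → IsΠ (`∃ φ)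

  bounded⇒Π : {φ : Formula n} → IsBounded φ → IsΠ φ
  bounded⇒Π (pos a)   = pos a
  bounded⇒Π (neg a)   = neg a
  bounded⇒Π (p `∧ q)  = bounded⇒Π p `∧ bounded⇒Π q
  bounded⇒Π (p `∨ q)  = bounded⇒Π p `∨ bounded⇒Π q
  bounded⇒Π (bd∀ t p) = `∀ (neg _ `∨ bounded⇒Π p)
  bounded⇒Π (bd∃ t p) = `∃≤ t (λ ρ y → x≤⟦⟧-strengthen {t = t} ∘ proj₁) (pos _ `∧ bounded⇒Π p)

  bounded⇒Σ : {φ : Formula n} → IsBounded φ → IsΣ φ
  bounded⇒Σ (pos a)   = pos a
  bounded⇒Σ (neg a)   = neg a
  bounded⇒Σ (p `∧ q)  = bounded⇒Σ p `∧ bounded⇒Σ q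
  bounded⇒Σ (p `∨ q)  = bounded⇒Σ p `∨ bounded⇒Σ q
  bounded⇒Σ (bd∀ t p) = bd∀ t (bounded⇒Σ p)
  bounded⇒Σ (bd∃ t p) = bd∃ t (bounded⇒Σ p)

  -- Universal quantifiers range over fewer objects when forced, and an existential witness lies
  -- below a term value, hence is controlled. A disjunction splits the world by the disjunct that is
  -- true.
  Π-true⇒⊩ : ∀ {φ : Formula n} {w ρ} → IsΠ φ → ControlledEnv w ρ → (∀ x → ℕ⊨[ ρ x ] φ) → w , ρ ⊩ φ
  Π-true⇒⊩ (pos a)  cρ ⊨φ r ⊭a = collapses-empty λ x → ⊭a x (⊨φ _)
  Π-true⇒⊩ (neg a)  cρ ⊨φ r ⊨a = collapses-empty λ x → ⊨φ _ (⊨a x)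
  Π-true⇒⊩ (p `∧ q) cρ ⊨φ = Π-true⇒⊩ p cρ (proj₁ ∘ ⊨φ) , Π-true⇒⊩ q cρ (proj₂ ∘ ⊨φ)
  Π-true⇒⊩ {φ = φ `∨ ψ} {ρ = ρ} (p `∨ q) cρ ⊨φ {v} r f g =
    collapses-¬¬ (λ x ¬em → ¬em (⊨φ (reindex r x))) (collapses-⊎
      (f (restrict-≼ _) (Π-true⇒⊩ p (controlled-reindex (restrict-≼ _) (controlled-reindex r cρ)) proj₂))
      (g (restrict-≼ _) (Π-true⇒⊩ q (controlled-reindex (restrict-≼ _) (controlled-reindex r cρ)) proj₂)))
  Π-true⇒⊩ (`∀ p) cρ ⊨φ r {e} ce = Π-true⇒⊩ p (controlled-extend ce (controlled-reindex r cρ)) (λ x → ⊨φ _ (e x))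
  Π-true⇒⊩ (`∃≤ t y≤t p) cρ ⊨φ r f = f ≼ʷ-refl ce ≼ʷ-refl
    (Π-true⇒⊩ p (controlled-extend ce (controlled-reindex r cρ)) (λ x → proj₂ (⊨φ _)))
    where ce = controlled-≤ (λ x → y≤t _ _ (proj₂ (⊨φ (reindex r x)))) (controlled-term (controlled-reindex r cρ) t)

  ¬¬-bounded-∀ : ∀ n {P : ℕ → Set} → (∀ i → i < n → ¬ ¬ P i) → ¬ ¬ (∀ i → i < n → P i)
  ¬¬-bounded-∀ zero    f k = k λ _ ()
  ¬¬-bounded-∀ (suc n) {P} f k = f n ≤-refl λ Pn → ¬¬-bounded-∀ n (λ i i<n → f i (m≤n⇒m≤1+n i<n)) λ g →
    k λ i i<1+n → [ g i , (λ { refl → Pn }) ]′ (m<1+n⇒m<n∨m≡n i<1+n)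

  -- Values of controlled functions are genuine numbers, so forced witnesses would be true ones. A
  -- counterexample to a bounded universal quantifier lies below a controlled bound, so it can be
  -- added to the index and names an element.
  Σ-reflection : ∀ {φ : Formula n} {w ρ} → IsΣ φ → ControlledEnv w ρ →
                 w , ρ ⊩ φ → (∀ x → ¬ (ℕ⊨[ ρ x ] φ)) → Collapses w
  -- Kept separate for the bounded existential quantifier, whose conjunctive body has no derivation
  -- of its own inside `bd∃`; the recursion then descends to `p` directly.
  Σ-reflection-∧ : ∀ {φ ψ : Formula n} {w ρ} → IsΣ φ → IsΣ ψ → ControlledEnv w ρ →
                   w , ρ ⊩ φ `∧ ψ → (∀ x → ¬ (ℕ⊨[ ρ x ] (φ `∧ ψ))) → Collapses w

  Σ-reflection (pos a) cρ f ⊭φ = f ≼ʷ-refl ⊭φ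
  Σ-reflection (neg a) cρ f ⊭φ = collapses-¬¬ ⊭φ (f (restrict-≼ _) proj₂)
  Σ-reflection (p `∧ q) cρ f ⊭φ = Σ-reflection-∧ p q cρ f ⊭φ
  Σ-reflection (p `∨ q) cρ f ⊭φ = f ≼ʷ-refl
    (λ r g → Σ-reflection p (controlled-reindex r cρ) g (λ x → ⊭φ _ ∘ inj₁))
    (λ r g → Σ-reflection q (controlled-reindex r cρ) g (λ x → ⊭φ _ ∘ inj₂))
  Σ-reflection {w = w} {ρ} (bd∀ t {φ} p) cρ f ⊭φ = collapses-¬¬ ¬¬fails
    (f r cy ≼ʷ-refl
      (λ s g → g ≼ʷ-refl λ x → let _ , y , y≤t , _ = reindex s x in x≤⟦⟧-weaken {t = t} y≤t)
      (λ s g → Σ-reflection p (controlled-reindex s cyρ) g λ x → let _ , _ , _ , ⊭y = reindex s x in ⊭y))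
    where
    Fails : Index w → Set
    Fails x = ∃[ y ] y ≤ ⟦ t ⟧ (ρ x) × ¬ (ℕ⊨[ y ∷ᶠ ρ x ] φ)
    r : restrict w Fails ≼ʷ w
    r = restrict-≼ Fails
    cy : Controlled (restrict w Fails) (proj₁ ∘ proj₂)
    cy = controlled-≤ (proj₁ ∘ proj₂ ∘ proj₂) (controlled-term (controlled-reindex r cρ) t)
    cyρ = controlled-extend cy (controlled-reindex r cρ)
    ¬¬fails : ∀ x → ¬ ¬ Fails x
    ¬¬fails x ¬fails = ¬¬-bounded-∀ (suc (⟦ t ⟧ (ρ x))) (λ y y≤t ⊭y → ¬fails (y , s≤s⁻¹ y≤t , ⊭y)) λ ⊨φ →
      ⊭φ x λ y → case y ≤? ⟦ renameTerm suc t ⟧ (y ∷ᶠ ρ x) of λ where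
        (yes y≤t) → inj₂ (⊨φ y (s≤s (x≤⟦⟧-strengthen {t = t} y≤t)))
        (no y≰t)  → inj₁ y≰t
  Σ-reflection (bd∃ t p) cρ f ⊭φ = f ≼ʷ-refl λ s {e} ce r g → Σ-reflection-∧ (pos (x₀ ≼ renameTerm suc t)) p
    (controlled-reindex r (controlled-extend ce (controlled-reindex s cρ))) g (λ x ⊨ψ → ⊭φ _ (_ , ⊨ψ))
  Σ-reflection (`∃ p) cρ f ⊭φ = f ≼ʷ-refl λ s {e} ce r g → Σ-reflection p
    (controlled-reindex r (controlled-extend ce (controlled-reindex s cρ))) g (λ x ⊨ψ → ⊭φ _ (_ , ⊨ψ))

  Σ-reflection-∧ {φ = φ} {ψ} p q cρ (f , g) ⊭φ =
    collapses-¬¬ (λ x ¬em → ¬em (inj₁ λ ⊨φ → ¬em (inj₂ λ ⊨ψ → ⊭φ x (⊨φ , ⊨ψ)))) (collapses-⊎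
      (Σ-reflection p (controlled-reindex (restrict-≼ _) cρ) (⊩-mono φ (restrict-≼ _) f) proj₂)
      (Σ-reflection q (controlled-reindex (restrict-≼ _) cρ) (⊩-mono ψ (restrict-≼ _) g) proj₂))

  -- Deciding bounded formulas and counting witnessed numbers

  decideAtom : ∀ (a : Atom n) ρ → Dec (ℕ⊨ᵃ[ ρ ] a)
  decideAtom (s ≐ t) ρ = ⟦ s ⟧ ρ ≟ ⟦ t ⟧ ρ
  decideAtom (s ≼ t) ρ = ⟦ s ⟧ ρ ≤? ⟦ t ⟧ ρ

  decide : ∀ {φ : Formula n} → IsBounded φ → ∀ ρ → Dec (ℕ⊨[ ρ ] φ)
  decide (pos a)  ρ = decideAtom a ρ
  decide (neg a)  ρ = ¬? (decideAtom a ρ)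
  decide (p `∧ q) ρ = decide p ρ ×-dec decide q ρ
  decide (p `∨ q) ρ = decide p ρ ⊎-dec decide q ρ
  decide (bd∀ t {φ} p) ρ = map′
    (λ ⊨φ y → case y ≤? ⟦ renameTerm suc t ⟧ (y ∷ᶠ ρ) of λ where
      (yes y≤t) → inj₂ (⊨φ (s≤s (x≤⟦⟧-strengthen {t = t} y≤t)))
      (no y≰t)  → inj₁ y≰t)
    (λ ⊨φ {y} y≤t → [ (λ y≰t → contradiction (x≤⟦⟧-weaken {t = t} (s≤s⁻¹ y≤t)) y≰t) , id ]′ (⊨φ y))
    (allUpTo? (λ y → decide p (y ∷ᶠ ρ)) (suc (⟦ t ⟧ ρ)))
  decide (bd∃ t {φ} p) ρ = map′
    (λ (y , y≤t , ⊨φ) → y , x≤⟦⟧-weaken {t = t} (s≤s⁻¹ y≤t) , ⊨φ)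
    (λ (y , y≤t , ⊨φ) → y , s≤s (x≤⟦⟧-strengthen {t = t} y≤t) , ⊨φ)
    (anyUpTo? (λ y → decide p (y ∷ᶠ ρ)) (suc (⟦ t ⟧ ρ)))

  -- S increases on each [c , F k c], which can happen at most N times.

  constant-intervals : ∀ {S : ℕ → ℕ} {N k lo hi} → (∀ {c d} → c ≤ d → S c ≤ S d) → (∀ c → S c ≤ N) →
                       (∀ {c d} → lo ≤ c → c ≤ d → d ≤ hi → S c ≡ S d → d < F k c) →
                       hi < fold lo (F k) (suc N)
  constant-intervals {S} {N} {k} {lo} {hi} mono S≤N short =
    [ (λ N<S → contradiction (S≤N _) (<⇒≱ N<S)) , id ]′ (stages (suc N))
    where
    stages : ∀ s → s ≤ S (fold lo (F k) s) ⊎ hi < fold lo (F k) s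
    stages zero    = inj₁ z≤n
    stages (suc s) with stages s
    ... | inj₂ hi<c = inj₂ (<-≤-trans hi<c (F-≤ k _))
    ... | inj₁ s≤Sc with F k (fold lo (F k) s) ≤? hi
    ...   | no d≰hi  = inj₂ (≰⇒> d≰hi)
    ...   | yes d≤hi = inj₁ (≤-<-trans s≤Sc (≤∧≢⇒< (mono (F-≤ k _)) λ Sc≡Sd →
      <-irrefl refl (short (fold-inflationary (F-≤ k) s) (F-≤ k _) d≤hi Sc≡Sd)))

  ⁅_⁆? : {P : ℕ → Set} → Decidable P → ∀ n → Subset n
  ⁅ P? ⁆? n = tabulate (does ∘ P? ∘ toℕ)

  module _ {P : ℕ → Set} {P? : Decidable P} {n : ℕ} {i : Fin n} where

    ∈-⁅⁆?⁺ : P (toℕ i) → i Subset.∈ ⁅ P? ⁆? n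
    ∈-⁅⁆?⁺ p = lookup⇒[]= i _ (trans (lookup∘tabulate _ i) (dec-true (P? (toℕ i)) p))

    ∈-⁅⁆?⁻ : i Subset.∈ ⁅ P? ⁆? n → P (toℕ i)
    ∈-⁅⁆?⁻ i∈ with P? (toℕ i) | trans (sym (lookup∘tabulate (does ∘ P? ∘ toℕ) i)) ([]=⇒lookup i∈)
    ... | yes p | _ = p

  ∣⁅⁆?∣-mono : ∀ {P R : ℕ → Set} (P? : Decidable P) (R? : Decidable R) n → (∀ {i} → P i → R i) →
               ∣ ⁅ P? ⁆? n ∣ ≤ ∣ ⁅ R? ⁆? n ∣
  ∣⁅⁆?∣-mono P? R? n P⇒R = p⊆q⇒∣p∣≤∣q∣ {p = ⁅ P? ⁆? n} {⁅ R? ⁆? n} (∈-⁅⁆?⁺ {P? = R?} ∘ P⇒R ∘ ∈-⁅⁆?⁻ {P? = P?})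

  ∣⁅⁆?∣-≡ : ∀ {P R : ℕ → Set} (P? : Decidable P) (R? : Decidable R) {n} → (∀ {i} → P i → R i) →
            ∣ ⁅ P? ⁆? n ∣ ≡ ∣ ⁅ R? ⁆? n ∣ → ∀ {i} → i < n → R i → P i
  ∣⁅⁆?∣-≡ {P} {R} P? R? {n} P⇒R eq {i} i<n Ri = decidable-stable (P? i) λ ¬Pi → <-irrefl eq
    (p⊂q⇒∣p∣<∣q∣ {p = ⁅ P? ⁆? n} {⁅ R? ⁆? n} ( (∈-⁅⁆?⁺ {P? = R?} ∘ P⇒R ∘ ∈-⁅⁆?⁻ {P? = P?})
                 , fromℕ< i<n
                 , ∈-⁅⁆?⁺ {P? = R?} (subst R (sym (toℕ-fromℕ< i<n)) Ri)
                 , ¬Pi ∘ subst P (toℕ-fromℕ< i<n) ∘ ∈-⁅⁆?⁻ {P? = P?}))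

  starts-ends-or-jumps : ∀ {P : ℕ → Set} → Decidable P → ∀ n → ¬ P 0 ⊎ P n ⊎ (∃[ i ] i < n × P i × ¬ P (suc i))
  starts-ends-or-jumps P? n with P? n
  ... | yes Pn = inj₂ (inj₁ Pn)
  starts-ends-or-jumps P? zero    | no ¬P0 = inj₁ ¬P0
  starts-ends-or-jumps P? (suc n) | no ¬P1+n with starts-ends-or-jumps P? n
  ... | inj₁ ¬P0                      = inj₁ ¬P0
  ... | inj₂ (inj₁ Pn)                = inj₂ (inj₂ (n , ≤-refl , Pn , ¬P1+n))
  ... | inj₂ (inj₂ (i , i<n , found)) = inj₂ (inj₂ (i , m≤n⇒m≤1+n i<n , found))

  -- Forcing Σ₁-induction

  ⊩∃-intro : ∀ {θ : Formula (suc n)} {w ρ} → IsBounded θ → ControlledEnv w ρ → {y : Index w → ℕ} → Controlled w y →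
             (∀ x → ℕ⊨[ y x ∷ᶠ ρ x ] θ) → w , ρ ⊩ `∃ θ
  ⊩∃-intro p cρ cy ⊨θ r f = f ≼ʷ-refl (controlled-mono r cy) ≼ʷ-refl
    (Π-true⇒⊩ (bounded⇒Π p) (controlled-reindex r (controlled-extend cy cρ)) (λ x → ⊨θ (reindex r x)))

  -- Falsity up to hi suffices, as an element can exceed hi at a collapsing part only.

  ⊩∃-refute : ∀ {θ : Formula (suc n)} {w ρ} → IsBounded θ → ControlledEnv w ρ →
              (∀ x y → y ≤ hi w x → ¬ (ℕ⊨[ y ∷ᶠ ρ x ] θ)) → w , ρ ⊩ `∃ θ → Collapses w
  ⊩∃-refute {θ = θ} {w} {ρ} p cρ ⊭θ f = f ≼ʷ-refl λ {u} s {e} ce {v} t g →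
    let Below = λ x → e (reindex t x) ≤ hi v x ; r = restrict-≼ {v} Below in
    collapses-em
      (Σ-reflection (bounded⇒Σ p)
        (controlled-reindex r (controlled-reindex t (controlled-extend ce (controlled-reindex s cρ))))
        (⊩-mono θ {ρ = extend e (ρ ∘ reindex s) ∘ reindex t} r g)
        (λ (x , e≤hi) → ⊭θ _ _ (≤-trans e≤hi (≤-trans (hi-≥ t x) (hi-≥ s _)))))
      (let control k e≤ = controlled-mono t ce in
        collapse k λ (x , e≰hi) → <-≤-trans (≰⇒> e≰hi) (e≤ x))

  module Induction {θ : Formula (suc (suc n))} (p : IsBounded θ) {w : World}
    {ρ : Env w n} (cρ : ControlledEnv w ρ) {e : Index w → ℕ} (ce : Controlled w e) where

    Witnessed : Index w → ℕ → ℕ → Set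
    Witnessed x c i = ∃[ y ] y < suc c × ℕ⊨[ y ∷ᶠ i ∷ᶠ ρ x ] θ

    witnessed? : ∀ x c → Decidable (Witnessed x c)
    witnessed? x c i = anyUpTo? (λ y → decide p (y ∷ᶠ i ∷ᶠ ρ x)) (suc c)

    witnessed-mono : ∀ {x c d i} → c ≤ d → Witnessed x c i → Witnessed x d i
    witnessed-mono c≤d (y , y≤c , ⊨θ) = y , <-≤-trans y≤c (s≤s c≤d) , ⊨θ

    number : Index w → ℕ → ℕ
    number x c = ∣ ⁅ witnessed? x c ⁆? (suc (e x)) ∣

    number-mono : ∀ x {c d} → c ≤ d → number x c ≤ number x d
    number-mono x {c} {d} c≤d =
      ∣⁅⁆?∣-mono (witnessed? x c) (witnessed? x d) (suc (e x)) (witnessed-mono c≤d)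

    -- Cutting the intervals of w into pieces [c , d] such that no i ≤ e has its least witness
    -- in (c , d] turns truth of `∃ θ at i into truth of a bounded formula, to which the least
    -- number principle applies. This adapts the Paris–Kirby proof that semiregular cuts
    -- satisfy Σ₁-induction.

    intervals : World
    intervals = record
      { Index = Σ[ x ∈ Index w ] Σ[ c ∈ ℕ ] Σ[ d ∈ ℕ ]
                lo w x ≤ c × c ≤ d × d ≤ hi w x × number x c ≡ number x d
      ; lo = λ (_ , c , _) → c
      ; hi = λ (_ , _ , d , _) → d
      }

    intervals-≼ : intervals ≼ʷ w
    intervals-≼ = record
      { reindex = proj₁
      ; lo-≤    = λ (_ , _ , _ , lo≤c , _) → lo≤c
      ; hi-≥    = λ (_ , _ , _ , _ , _ , d≤hi , _) → d≤hi
      }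

    -- The count is at most `suc (e x)`, so 2 + `e x` iterations of `F k` pass `hi`. With `e x`
    -- below z, they are dominated by 2 + z iterations from `suc z`, which is `F (suc k) z` by
    -- definition.
    collapses-intervals : Collapses intervals → Collapses w
    collapses-intervals (collapse k short) = let control l e≤ = ce in
      collapse (suc (suc k ⊔ l)) λ x → let z = F l (lo w x) in begin-strict
        hi w x                           <⟨ constant-intervals {number x} {k = k}
                                              (number-mono x)
                                              (λ c → ∣p∣≤n (⁅ witnessed? x c ⁆? (suc (e x))))
                                              (λ lo≤c c≤d d≤hi eq → short (x , _ , _ , lo≤c , c≤d , d≤hi , eq)) ⟩
        fold (lo w x) (F k) (2 + e x)    ≤⟨ fold-mono (F-monoʳ k) (2 + e x) (m≤n⇒m≤1+n (F-≤ l (lo w x))) ⟩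
        fold (suc z) (F k) (2 + e x)     ≤⟨ fold-monoʳ (F-≤ k) (+-monoʳ-≤ 2 (e≤ x)) ⟩
        F (suc k) z                      ≤⟨ F-comp (suc k) l (lo w x) ⟩
        F (suc (suc k ⊔ l)) (lo w x)     ∎
      where open ≤-Reasoning

    unwitnessed : ∀ (z : Index intervals) {i} → let x , c , d , _ = z in
                  i ≤ e x → ¬ Witnessed x c i → ∀ y → y ≤ d → ¬ (ℕ⊨[ y ∷ᶠ i ∷ᶠ ρ x ] θ)
    unwitnessed (x , c , d , _ , c≤d , _ , eq) i≤e ¬witnessed y y≤d ⊨θ = ¬witnessed
      (∣⁅⁆?∣-≡ (witnessed? x c) (witnessed? x d) (witnessed-mono c≤d) eq (s≤s i≤e) (y , s≤s y≤d , ⊨θ))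

    controlled-lo : ∀ {v} → Controlled v (lo v)
    controlled-lo {v} = control 0 λ x → n≤1+n (lo v x)

    -- On a piece, a witness up to its lower end is controlled and makes the existential formula
    -- forced, while absence of one there persists up to the upper end and refutes it. Hence each
    -- piece contradicts `base`, `end` or one instance of `step`.
    Σ₁-induction : w , extend (λ _ → 0) ρ ⊩ `∃ θ →
      (∀ {v} (r : v ≼ʷ w) {i} → Controlled v i →
        v , extend i (ρ ∘ reindex r) ⊩ `∃ θ → v , extend (suc ∘ i) (ρ ∘ reindex r) ⊩ `∃ θ) →
      w , extend e ρ ⊮ `∃ θ → Collapses w
    Σ₁-induction base step end = collapses-intervals
      (collapses-¬¬ (λ (x , c , _) ¬least → ¬least (starts-ends-or-jumps (witnessed? x c) (e x)))
        (collapses-⊎ initial (collapses-⊎ final jump)))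
      where
      Initial Final Jump : Index intervals → Set
      Initial (x , c , _) = ¬ Witnessed x c 0
      Final   (x , c , _) = Witnessed x c (e x)
      Jump    (x , c , _) = ∃[ i ] i < e x × Witnessed x c i × ¬ Witnessed x c (suc i)

      part : ∀ P → restrict intervals P ≼ʷ w
      part P = ≼ʷ-trans (restrict-≼ P) intervals-≼

      witnesses : ∀ P {i} → Controlled (restrict intervals P) i →
        (∀ z → let (x , c , _) , _ = z in Witnessed x c (i z)) →
        restrict intervals P , extend i (ρ ∘ reindex (part P)) ⊩ `∃ θ
      witnesses P ci witnessed = ⊩∃-intro p (controlled-extend ci (controlled-reindex (part P) cρ))
        (controlled-≤ (λ x → s≤s⁻¹ (proj₁ (proj₂ (witnessed x)))) controlled-lo)
        (λ x → proj₂ (proj₂ (witnessed x)))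

      initial : Collapses (restrict intervals Initial)
      initial = ⊩∃-refute p
        (controlled-extend (control 0 λ _ → z≤n) (controlled-reindex (part Initial) cρ))
        (λ (x , ¬witnessed) → unwitnessed x z≤n ¬witnessed)
        (⊩-mono (`∃ θ) {ρ = extend (λ _ → 0) ρ} (part Initial) base)

      final : Collapses (restrict intervals Final)
      final = end (part Final) (witnesses Final (controlled-mono (part Final) ce) proj₂)

      jump : Collapses (restrict intervals Jump)
      jump = ⊩∃-refute p
        (controlled-extend (controlled-F 0 ci) (controlled-reindex (part Jump) cρ))
        (λ (x , _ , i<e , _ , ¬witnessed) → unwitnessed x i<e ¬witnessed)
        (step (part Jump) ci (witnesses Jump ci λ (_ , _ , _ , witnessed , _) → witnessed))
        where
        ci : Controlled (restrict intervals Jump) (λ (_ , i , _) → i)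
        ci = controlled-≤ (λ (_ , _ , i<e , _) → <⇒≤ i<e) (controlled-mono (part Jump) ce)

  ⊩-induction : ∀ {φ : Formula (suc n)} {w ρ} → IsΣ₁ φ → ControlledEnv w ρ → w , ρ ⊩ induction φ
  ⊩-induction {n} {`∃ θ} {ρ = ρ} (`∃ p) cρ =
    ⊩-⇒-intro (φ [ `0 ] `∧ `∀ (φ ⇒ φS)) (`∀ φ) {ρ = ρ} λ r → ∀-from-steps (controlled-reindex r cρ)
    where
    φ φS : Formula (suc n)
    φ  = `∃ θ
    φS = φ ⟪ `S x₀ ∷ᶠ (var ∘ suc) ⟫

    interprets-S : ∀ a (ρ : Vector ℕ n) → Interprets (`S x₀ ∷ᶠ (var ∘ suc)) (a ∷ᶠ ρ) (suc a ∷ᶠ ρ)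
    interprets-S a ρ zero    = refl
    interprets-S a ρ (suc i) = refl

    ∀-from-steps : ∀ {w ρ} → ControlledEnv w ρ → w , ρ ⊩ φ [ `0 ] `∧ `∀ (φ ⇒ φS) → w , ρ ⊩ `∀ φ
    ∀-from-steps {w} {ρ} cρ (base , step) s {e} ce = ⊩-stable φ {ρ = extend e (ρ ∘ reindex s)} λ t end →
      let r = ≼ʷ-trans t s in
      Induction.Σ₁-induction p (controlled-reindex r cρ) (controlled-mono t ce)
        (⊩-subst⁻ φ (`0 ∷ᶠ var) {ρ′ = extend (λ _ → 0) (ρ ∘ reindex r)} (λ _ → interprets-[] `0 _)
          (⊩-mono (φ [ `0 ]) {ρ = ρ} r base))
        (λ q {i} ci f → let ρ′ = ρ ∘ reindex r ∘ reindex q in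
          ⊩-subst⁻ φ (`S x₀ ∷ᶠ (var ∘ suc)) {ρ = extend i ρ′} {extend (suc ∘ i) ρ′}
            (λ x → interprets-S (i x) (ρ′ x))
            (⊩-⇒-elim φ φS {ρ = extend i ρ′} (step (≼ʷ-trans q r) ci) f))
        end

  -- Validity of the axioms

  record Valid (φ : Formula n) : Set₁ where
    constructor validity
    field
      forces : ∀ {w} {ρ : Env w n} → ControlledEnv w ρ → w , ρ ⊩ φ

  open Valid

  valid-closure : ∀ n {φ : Formula n} → Valid φ → Valid (closure φ)
  valid-closure zero    valid = valid
  valid-closure (suc n) {φ} valid = valid-closure n {`∀ φ} (validity λ cρ r ce →
    forces valid (controlled-extend ce (controlled-reindex r cρ)))

  Π-valid : ∀ n {φ : Formula n} → IsΠ φ → (∀ ρ → ℕ⊨[ ρ ] φ) → Valid (closure φ)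
  Π-valid n p ⊨φ = valid-closure n (validity λ cρ → Π-true⇒⊩ p cρ λ _ → ⊨φ _)

  implies : {A B : Set} → Dec A → (A → B) → ¬ A ⊎ B
  implies (yes a) f = inj₂ (f a)
  implies (no ¬a) f = inj₁ ¬a

  implies₂ : {A B C : Set} → Dec A → Dec B → (A → B → C) → (¬ A ⊎ ¬ B) ⊎ C
  implies₂ (no ¬a) _       f = inj₁ (inj₁ ¬a)
  implies₂ (yes a) (no ¬b) f = inj₁ (inj₂ ¬b)
  implies₂ (yes a) (yes b) f = inj₂ (f a b)

  Q-valid : ∀ {σ} → Q σ → Valid σ
  Q-valid ≐-refl  = Π-valid 1 (pos _) λ ρ → refl
  Q-valid ≐-sym   = Π-valid 2 (neg _ `∨ pos _) λ ρ → implies (_ ≟ _) sym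
  Q-valid ≐-trans = Π-valid 3 ((neg _ `∨ neg _) `∨ pos _) λ ρ → implies₂ (_ ≟ _) (_ ≟ _) trans
  Q-valid S-cong  = Π-valid 2 (neg _ `∨ pos _) λ ρ → implies (_ ≟ _) (cong suc)
  Q-valid ⊕-cong  = Π-valid 4 ((neg _ `∨ neg _) `∨ pos _) λ ρ → implies₂ (_ ≟ _) (_ ≟ _) (cong₂ _+_)
  Q-valid ⊗-cong  = Π-valid 4 ((neg _ `∨ neg _) `∨ pos _) λ ρ → implies₂ (_ ≟ _) (_ ≟ _) (cong₂ _*_)
  Q-valid ≼-cong  = Π-valid 4 ((neg _ `∨ neg _) `∨ (neg _ `∨ pos _)) λ ρ →
    implies₂ (_ ≟ _) (_ ≟ _) λ eq eq′ → implies (_ ≤? _) (subst₂ _≤_ eq eq′)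
  Q-valid S-inj   = Π-valid 2 (neg _ `∨ pos _) λ ρ → implies (_ ≟ _) suc-injective
  Q-valid ≠0-def  = Π-valid 1
    ((pos _ `∨ `∃≤ x₀ (λ ρ y eq → ≤-trans (n≤1+n y) (≤-reflexive (sym eq))) (pos _)) `∧ (`∀ (neg _) `∨ neg _))
    λ ρ → ≢0⇒suc (ρ zero) , suc⇒≢0 (ρ zero)
    where
    ≢0⇒suc : ∀ a → a ≡ 0 ⊎ ∃[ y ] a ≡ suc y
    ≢0⇒suc zero    = inj₁ refl
    ≢0⇒suc (suc a) = inj₂ (a , refl)
    suc⇒≢0 : ∀ a → (∀ y → ¬ (a ≡ suc y)) ⊎ ¬ (a ≡ 0)
    suc⇒≢0 zero    = inj₁ λ _ ()
    suc⇒≢0 (suc a) = inj₂ λ ()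
  Q-valid ≼-def   = Π-valid 2
    ((neg _ `∨ `∃≤ x₁ (λ ρ y eq → ≤-trans (m≤m+n y _) (≤-reflexive eq)) (pos _)) `∧ (`∀ (neg _) `∨ pos _))
    λ ρ → implies (_ ≤? _) (λ le → _ , m∸n+n≡m le) , +⇒≤ (ρ zero) (ρ (suc zero))
    where
    +⇒≤ : ∀ a b → (∀ y → ¬ (y + a ≡ b)) ⊎ a ≤ b
    +⇒≤ a b with a ≤? b
    ... | yes a≤b = inj₂ a≤b
    ... | no a≰b  = inj₁ λ { y refl → a≰b (m≤n+m a y) }
  Q-valid ⊕-0     = Π-valid 1 (pos _) λ ρ → +-identityʳ _
  Q-valid ⊕-S     = Π-valid 2 (pos _) λ ρ → +-suc _ _
  Q-valid ⊗-0     = Π-valid 1 (pos _) λ ρ → *-zeroʳ (ρ zero)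
  Q-valid ⊗-S     = Π-valid 2 (pos _) λ ρ → trans (*-suc (ρ zero) _) (+-comm (ρ zero) _)

  IΣ₁-valid : ∀ {σ} → IΣ₁ σ → Valid σ
  IΣ₁-valid (robinson q)    = Q-valid q
  IΣ₁-valid (Σ₁-ind {n} p)  = valid-closure n (validity (⊩-induction p))

  IΣ₁-sound : ∀ {φ} → IΣ₁ ⊢ φ → ∀ {w} → w , (λ _ ()) ⊩ φ
  IΣ₁-sound {φ} ⊢φ = ⊩-stable φ {ρ = λ _ ()} λ r f →
    soundness (λ Tσ → forces (IΣ₁-valid Tσ) λ ()) ⊢φ {ρ = λ _ ()} (λ ()) ((λ {_} → f) ∷ [])

open Forcing
open _≼ʷ_

-- The Goodstein world

-- The lower end is the start value itself, which thereby names an element of the cut; the upper end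
-- is a time at which that sequence is still positive.
goodsteinWorld : World
goodsteinWorld = record { Index = ℕ ; lo = λ e → 2 ^ suc e ; hi = λ e → F e 0 }

goodsteinWorld-proper : ¬ Collapses goodsteinWorld
-- At index 3 + k the lower end is 2 to the power 4 + k, as the diagonal bound requires.
goodsteinWorld-proper (collapse k hi<) = <⇒≱ (hi< (3 + k)) (F-diagonal k)

open import Data.Vec.Functional using ([]; _∷_)

theorem4p2p22 : (φ : Formula 3) → IsΣ φ →
    (∀ i k n → G n i ≡ k ⇔ (ℕ⊨[ n ∷ i ∷ k ∷ [] ] φ)) →
    ¬ (IΣ₁ ⊢ `∀ (`∃ (φ ⟪ x₁ ∷ x₀ ∷ `0 ∷ [] ⟫)))
theorem4p2p22 φ Σφ defines ⊢φ = goodsteinWorld-proper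
  (IΣ₁-sound ⊢φ {goodsteinWorld} ≼ʷ-refl start ≼ʷ-refl refute)
  where
  start : Controlled goodsteinWorld (λ e → 2 ^ suc e)
  start = control 0 λ e → n≤1+n (2 ^ suc e)

  σ : Subst 3 2
  σ = x₁ ∷ x₀ ∷ `0 ∷ []

  -- The world is split by truth of `φ` at the proposed time. Where it is false, reflection applies;
  -- where it is true, the sequence has ended, so the controlled time exceeds the upper end.
  refute : ∀ {u} (s : u ≼ʷ goodsteinWorld) {i} → Controlled u i →
           u , extend i (extend (λ e → 2 ^ suc e) (λ _ ()) ∘ reindex s) ⊮ φ ⟪ σ ⟫
  refute s {i} ci {v} t ⊩φσ = collapses-em terminated
    (Σ-reflection Σφ (controlled-reindex part controlled) (⊩-mono φ {ρ = ρ} part ⊩φ) proj₂)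
    where
    r : v ≼ʷ goodsteinWorld
    r = ≼ʷ-trans t s

    ρ : Env v 3
    ρ x = 2 ^ suc (reindex r x) ∷ i (reindex t x) ∷ 0 ∷ []

    controlled : ControlledEnv v ρ
    controlled zero             = controlled-mono r start
    controlled (suc zero)       = controlled-mono t ci
    controlled (suc (suc zero)) = control 0 λ _ → z≤n

    ⊩φ : v , ρ ⊩ φ
    ⊩φ = ⊩-subst⁻ φ σ (λ x → λ { zero → refl ; (suc zero) → refl ; (suc (suc zero)) → refl }) ⊩φσ

    part : restrict v (λ x → ¬ (ℕ⊨[ ρ x ] φ)) ≼ʷ v
    part = restrict-≼ _

    terminated : Collapses (restrict v (λ x → ℕ⊨[ ρ x ] φ))
    terminated = let control k i≤ = controlled-mono t ci in collapse k λ (x , ⊨φ) →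
      ≤-<-trans (hi-≥ r x) (<-≤-trans (G≡0⇒F< (reindex r x) (Equivalence.from (defines _ _ _) ⊨φ)) (i≤ x))
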